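{- Let $r$ and $t$ be positive integers. There is no distance-regular graph with intersection array $$\{(2r+1)(4r+1)(4t-1),\ 8r(4rt-r+2t),\ (r+t)(4r+1);\ 1,\ (r+t)(4r+1),\ 4r(2r+1)(4t-1)\}.$$
   Context: A connected graph $\Gamma$ of diameter $d$ is distance-regular if there are constants $p^h_{ij}$ ($0\le h,i,j\le d$) such that for any two vertices $u,v$ at distance $h$, the number of vertices at distance $i$ from $u$ and distance $j$ from $v$ is $p^h_{ij}$. Its intersection array is $\{b_0,b_1,\dots,b_{d-1};c_1,c_2,\dots,c_d\}$ where $b_i=p^i_{1,i+1}$ and $c_{i+1}=p^{i+1}_{1,i}$. -}

module Defs where

open import Data.Nat using (ℕ; zero; suc; _+_; _≤_)
open import Data.Bool using (Bool; true; false; _∧_; _∨_; not; T; if_then_else_)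
open import Data.Fin using (Fin; toℕ; _≟_)
open import Data.List using (List; allFin; map)
open import Data.Bool.ListAction using (any)
open import Data.Nat.ListAction using (sum)
open import Data.Vec using (Vec; lookup)
open import Data.Product using (Σ; ∃; ∃-syntax; _×_)
open import Relation.Nullary.Decidable using (⌊_⌋)
open import Relation.Binary.PropositionalEquality using (_≡_)

record SimpleGraph (n : ℕ) : Set where
  field
    adj    : Fin n → Fin n → Bool
    sym    : ∀ u v → adj u v ≡ adj v u
    irrefl : ∀ u → adj u u ≡ false
open SimpleGraph public

module _ {n : ℕ} (G : SimpleGraph n) where

  reach : ℕ → Fin n → Fin n → Bool
  reach zero    u v = ⌊ u ≟ v ⌋
  reach (suc k) u v = reach k u v ∨ any (λ w → reach k u w ∧ adj G w v) (allFin n)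

  distIs : ℕ → Fin n → Fin n → Bool
  distIs zero    u v = reach zero u v
  distIs (suc h) u v = reach (suc h) u v ∧ not (reach h u v)

  count : (Fin n → Bool) → ℕ
  count P = sum (map (λ w → if P w then 1 else 0) (allFin n))

  ConnectedDiameter : ℕ → Set
  ConnectedDiameter d =
    (∀ u v → ∃[ h ] (h ≤ d × T (distIs h u v))) × (∃[ u ] ∃[ v ] T (distIs d u v))

  IsDistanceRegular : (d : ℕ) → (ℕ → ℕ → ℕ → ℕ) → Set
  IsDistanceRegular d p =
    ConnectedDiameter d ×
    (∀ h i j → h ≤ d → i ≤ d → j ≤ d → ∀ u v → T (distIs h u v) →
       count (λ w → distIs i u w ∧ distIs j v w) ≡ p h i j)

  -- G is distance-regular with intersection array {b_0,...,b_{d-1}; c_1,...,c_d}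
  -- (b : Vec ℕ d lists b_0..b_{d-1}; c : Vec ℕ d lists c_1..c_d)
  HasIntersectionArray : (d : ℕ) → Vec ℕ d → Vec ℕ d → Set
  HasIntersectionArray d b c =
    Σ (ℕ → ℕ → ℕ → ℕ) λ p → IsDistanceRegular d p ×
      (∀ (i : Fin d) → (p (toℕ i) 1 (suc (toℕ i)) ≡ lookup b i)
                     × (p (suc (toℕ i)) 1 (toℕ i) ≡ lookup c i))

{-# OPTIONS --safe #-}
module Submission where

-- Write a = (2r+1)(4t−1), p = 4r, q = 2r+1 and c = (r+t)(4r+1), so that the array is
-- {a(p+1), (a+1)p, c; 1, c, ap}; it forces p³₃₃ = p.  Let f and g be multiples of the cosine
-- sequences of the eigenvalues a and −(2r+1)(4r+1).  The corresponding Krein parameter vanishes,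
-- so ∑ₓ f(u,x) f(v,x) g(w,x) = 0 for all u, v, w: the sum over u, v of the squares of these
-- numbers is zero.
--
-- Let [ijk] be the number of vertices at distances i, j, k from u, v, w.  If u, v, w are pairwise
-- at distance 3, the three Krein equations add up to
-- 2p([331] + [313] + [133]) + (p+1)([332] + [323] + [233]) = 0, so every vertex x ≠ w at
-- distance 3 from u and v is also at distance 3 from w.  Hence any two vertices u, w at distance 3
-- lie in a clique of the distance-3 graph formed by u, w and the vertices at distance 3 from both.
--
-- Now let y be a third vertex of this clique and v a neighbour of y at distance 3 from w.  Then
-- d(u,v) = 2, [333] = 0 and [313] = 1 (only y counts), and the Krein equations give [133] = 1,
-- [113] + [331] = 4t and [113] − [331] = 1, which is impossible for integers.

open import Defs
open import Data.Bool using (true; false; _∧_; T; if_then_else_)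
open import Data.Bool.Properties using (T-∧; T-∨)
open import Data.Empty using (⊥; ⊥-elim)
open import Data.Fin using (Fin; toℕ; fromℕ<; zero; suc)
open import Data.Fin.Patterns using (0F; 1F; 2F; 3F)
import Data.Fin as Fin
import Data.Fin.Properties as Fin
open import Data.Integer using (ℤ; +_; 0ℤ; 1ℤ)
import Data.Integer as ℤ
import Data.Integer.Properties as ℤ
open import Data.Integer.Tactic.RingSolver using (solve-∀)
open import Data.List using (allFin; tabulate)
open import Data.List.Membership.Propositional using (lose)
open import Data.List.Membership.Propositional.Properties using (∈-allFin)
open import Data.List.Properties using (map-tabulate)
open import Data.List.Relation.Unary.Any using (satisfied)
open import Data.List.Relation.Unary.Any.Properties using (any⁺; any⁻)
open import Data.Nat using (ℕ)
import Data.Nat as ℕ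
import Data.Nat.ListAction as List
import Data.Nat.Properties as ℕ
open import Data.Product using (_×_; _,_; proj₁; proj₂; ∃-syntax)
open import Data.Sum using (_⊎_; inj₁; inj₂; [_,_]′)
open import Function using (_∘_; id; Equivalence)
open import Relation.Binary.PropositionalEquality using (_≡_; _≢_; refl; trans; cong; cong₂; subst; subst₂; module ≡-Reasoning) renaming (sym to ≡-sym)
open import Relation.Nullary using (¬_; Dec; yes; no; contradiction)
open import Relation.Nullary.Decidable using (⌊_⌋; toWitness; fromWitness; _×-dec_; _→-dec_; ¬?; from-yes)
open import Algebra.Properties.Semiring.Sum ℤ.+-*-semiring using (sum-syntax; sum-cong-≗; sum-replicate-zero; ∑-distrib-+; ∑-comm; *-distribˡ-sum)

-- Integer sums over finite sets and Kronecker deltas.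

δ : ∀ {m} → Fin m → Fin m → ℤ
δ i j = if ⌊ i Fin.≟ j ⌋ then 1ℤ else 0ℤ

module IntegerSums where
  open import Data.Integer using (_+_; _*_; _-_; _≤_; _<_)
  open ≡-Reasoning

  ∑-cong : ∀ {n} {f g : Fin n → ℤ} → (∀ x → f x ≡ g x) → ∑[ x < n ] f x ≡ ∑[ x < n ] g x
  ∑-cong {n} f≗g = sum-cong-≗ {n} f≗g

  ∑-zero : ∀ {n} {f : Fin n → ℤ} → (∀ x → f x ≡ 0ℤ) → ∑[ x < n ] f x ≡ 0ℤ
  ∑-zero {n} f≗0 = trans (∑-cong f≗0) (sum-replicate-zero n)

  ∑-+ : ∀ {n} (f g : Fin n → ℤ) → ∑[ x < n ] (f x + g x) ≡ ∑[ x < n ] f x + ∑[ x < n ] g x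
  ∑-+ = ∑-distrib-+

  ∑-* : ∀ {n} c (f : Fin n → ℤ) → ∑[ x < n ] (c * f x) ≡ c * ∑[ x < n ] f x
  ∑-* c f = ≡-sym (*-distribˡ-sum c f)

  ∑-single : ∀ {n} (f : Fin n → ℤ) k → (∀ x → x ≢ k → f x ≡ 0ℤ) → ∑[ x < n ] f x ≡ f k
  ∑-single f zero    f≗0 = trans (cong (λ s → f zero + s) (∑-zero λ x → f≗0 (suc x) λ ())) (ℤ.+-identityʳ _)
  ∑-single f (suc k) f≗0 = trans
    (cong₂ _+_ (f≗0 zero λ ()) (∑-single (f ∘ suc) k λ x x≢k → f≗0 (suc x) (x≢k ∘ Fin.suc-injective)))
    (ℤ.+-identityˡ _)

  ∑-nonneg : ∀ {n} (f : Fin n → ℤ) → (∀ x → 0ℤ ≤ f x) → 0ℤ ≤ ∑[ x < n ] f x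
  ∑-nonneg {ℕ.zero}  f 0≤f = ℤ.≤-refl
  ∑-nonneg {ℕ.suc n} f 0≤f = ℤ.+-mono-≤ (0≤f zero) (∑-nonneg (f ∘ suc) (0≤f ∘ suc))

  nonneg-+-zero : ∀ {i j} → 0ℤ ≤ i → 0ℤ ≤ j → i + j ≡ 0ℤ → i ≡ 0ℤ × j ≡ 0ℤ
  nonneg-+-zero {+ ℕ.zero} {+ ℕ.zero} _ _ _ = refl , refl
  nonneg-+-zero {+ ℕ.zero} {+ ℕ.suc _} _ _ ()
  nonneg-+-zero {+ ℕ.suc _} {+ _} _ _ ()

  ∑-nonneg-zero : ∀ {n} (f : Fin n → ℤ) → (∀ x → 0ℤ ≤ f x) → ∑[ x < n ] f x ≡ 0ℤ → ∀ x → f x ≡ 0ℤ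
  ∑-nonneg-zero {ℕ.suc n} f 0≤f ∑≡0 x
    with nonneg-+-zero (0≤f zero) (∑-nonneg (f ∘ suc) (0≤f ∘ suc)) ∑≡0 | x
  ... | f₀≡0 , _ | zero  = f₀≡0
  ... | _ , ∑′≡0 | suc y = ∑-nonneg-zero (f ∘ suc) (0≤f ∘ suc) ∑′≡0 y

  δ-refl : ∀ {m} (i : Fin m) → δ i i ≡ 1ℤ
  δ-refl i with i Fin.≟ i
  ... | yes _   = refl
  ... | no  i≢i = ⊥-elim (i≢i refl)

  δ-≢ : ∀ {m} {i j : Fin m} → i ≢ j → δ i j ≡ 0ℤ
  δ-≢ {i = i} {j} i≢j with i Fin.≟ j
  ... | yes i≡j = ⊥-elim (i≢j i≡j)
  ... | no  _   = refl

  δ-nonneg : ∀ {m} (i j : Fin m) → 0ℤ ≤ δ i j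
  δ-nonneg i j with i Fin.≟ j
  ... | yes _ = ℤ.+≤+ ℕ.z≤n
  ... | no  _ = ℤ.+≤+ ℕ.z≤n

  δ-* : ∀ {m} (i j : Fin m) (F : Fin m → ℤ) → δ i j * F j ≡ δ i j * F i
  δ-* i j F with i Fin.≟ j
  ... | yes refl = refl
  ... | no  _    = trans (ℤ.*-zeroˡ (F j)) (≡-sym (ℤ.*-zeroˡ (F i)))

  δ-idem : ∀ {m} (i j : Fin m) → δ i j * δ i j ≡ δ i j
  δ-idem i j with i Fin.≟ j
  ... | yes _ = refl
  ... | no  _ = refl

  ∑-δ : ∀ {m} (β : Fin m → ℤ) k → ∑[ j < m ] (β j * δ j k) ≡ β k
  ∑-δ β k = trans
    (∑-single (λ j → β j * δ j k) k λ j j≢k → trans (cong (β j *_) (δ-≢ j≢k)) (ℤ.*-zeroʳ (β j)))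
    (trans (cong (β k *_) (δ-refl k)) (ℤ.*-identityʳ (β k)))

  -- An exchange of summation that turns a pointwise expansion in indicators `F s` into a linear
  -- relation between their totals.
  ∑-linear : ∀ {m n} (coef : Fin m → ℤ) (F : Fin m → Fin n → ℤ) (h : Fin n → ℤ) →
    (∀ x → h x ≡ ∑[ s < m ] (coef s * F s x)) →
    ∑[ x < n ] h x ≡ ∑[ s < m ] (coef s * ∑[ x < n ] F s x)
  ∑-linear {m} {n} coef F h h≗ = begin
    ∑[ x < n ] h x                              ≡⟨ ∑-cong h≗ ⟩
    ∑[ x < n ] ∑[ s < m ] (coef s * F s x)      ≡⟨ ∑-comm (λ x s → coef s * F s x) ⟩
    ∑[ s < m ] ∑[ x < n ] (coef s * F s x)      ≡⟨ ∑-cong (λ s → ∑-* (coef s) (F s)) ⟩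
    ∑[ s < m ] (coef s * ∑[ x < n ] F s x)      ∎

  square-nonneg : ∀ i → 0ℤ ≤ i * i
  square-nonneg (+ ℕ.zero)    = ℤ.+≤+ ℕ.z≤n
  square-nonneg (ℤ.+[1+ _ ])  = ℤ.+≤+ ℕ.z≤n
  square-nonneg (ℤ.-[1+ _ ])  = ℤ.+≤+ ℕ.z≤n

  nonneg-product : ∀ {i j} → 0ℤ ≤ i → 0ℤ ≤ j → 0ℤ ≤ i * j
  nonneg-product {+ i} {+ j} _ _ = subst (0ℤ ≤_) (ℤ.pos-* i j) (ℤ.+≤+ ℕ.z≤n)

  0<* : ∀ {i j} → 0ℤ < i → 0ℤ < j → 0ℤ < i * j
  0<* {+ ℕ.suc _} {+ ℕ.suc _} _ _ = ℤ.+<+ (ℕ.s≤s ℕ.z≤n)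
  0<* {+ ℕ.zero}  {_}         (ℤ.+<+ ()) _
  0<* {+ ℕ.suc _} {+ ℕ.zero}  _ (ℤ.+<+ ())

  0<+1 : ∀ {i} → 0ℤ < i → 0ℤ < i + 1ℤ
  0<+1 {+ m} _ = subst (0ℤ <_) (ℤ.+-comm 1ℤ (+ m)) (ℤ.+<+ (ℕ.s≤s (ℕ.z≤n {m})))

  cancelˡ : ∀ {i j k} → 0ℤ < i → i * j ≡ i * k → j ≡ k
  cancelˡ {i} {j} {k} 0<i = ℤ.*-cancelˡ-≡ i j k {{ℤ.>-nonZero 0<i}}

  -- Solves for one of four intersection numbers whose row sum is known. The left side is the form
  -- to which a sum over `Fin 4` unfolds; the `y`s are the values already found for the other
  -- entries.
  entry₁ : ∀ {k k′ x₀ x₁ x₂ x₃ y₀ y₂ y₃} → x₀ + (x₁ + (x₂ + (x₃ + 0ℤ))) ≡ k → k ≡ k′ →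
    x₀ ≡ y₀ → x₂ ≡ y₂ → x₃ ≡ y₃ → x₁ ≡ k′ - y₀ - y₂ - y₃
  entry₁ {x₀ = x₀} {x₁} {x₂} {x₃} refl refl refl refl refl = identity x₀ x₁ x₂ x₃
    where
    identity : ∀ x₀ x₁ x₂ x₃ → x₁ ≡ x₀ + (x₁ + (x₂ + (x₃ + + 0))) - x₀ - x₂ - x₃
    identity = solve-∀

  entry₂ : ∀ {k k′ x₀ x₁ x₂ x₃ y₀ y₁ y₃} → x₀ + (x₁ + (x₂ + (x₃ + 0ℤ))) ≡ k → k ≡ k′ →
    x₀ ≡ y₀ → x₁ ≡ y₁ → x₃ ≡ y₃ → x₂ ≡ k′ - y₀ - y₁ - y₃
  entry₂ {x₀ = x₀} {x₁} {x₂} {x₃} refl refl refl refl refl = identity x₀ x₁ x₂ x₃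
    where
    identity : ∀ x₀ x₁ x₂ x₃ → x₂ ≡ x₀ + (x₁ + (x₂ + (x₃ + + 0))) - x₀ - x₁ - x₃
    identity = solve-∀

  entry₃ : ∀ {k k′ x₀ x₁ x₂ x₃ y₀ y₁ y₂} → x₀ + (x₁ + (x₂ + (x₃ + 0ℤ))) ≡ k → k ≡ k′ →
    x₀ ≡ y₀ → x₁ ≡ y₁ → x₂ ≡ y₂ → x₃ ≡ k′ - y₀ - y₁ - y₂
  entry₃ {x₀ = x₀} {x₁} {x₂} {x₃} refl refl refl refl refl = identity x₀ x₁ x₂ x₃
    where
    identity : ∀ x₀ x₁ x₂ x₃ → x₃ ≡ x₀ + (x₁ + (x₂ + (x₃ + + 0))) - x₀ - x₁ - x₂
    identity = solve-∀

-- Distance-regularity of diameter at most three, stated with integer sums, and its counting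
-- identities.

record DistanceScheme (n : ℕ) : Set where
  field
    d        : Fin n → Fin n → Fin 4
    d-refl   : ∀ u → d u u ≡ 0F
    d-zero   : ∀ {u v} → d u v ≡ 0F → u ≡ v
    d-sym    : ∀ u v → d u v ≡ d v u
    triangle : ∀ u x v → toℕ (d u v) ℕ.≤ toℕ (d u x) ℕ.+ toℕ (d v x)
    P        : Fin 4 → Fin 4 → Fin 4 → ℤ
    regular  : ∀ i j u v → ∑[ x < n ] (δ i (d u x) ℤ.* δ j (d v x)) ≡ P (d u v) i j

module Counting {n : ℕ} (S : DistanceScheme n) where
  open import Data.Integer using (_*_)
  open IntegerSums
  open DistanceScheme S public
  open ≡-Reasoning

  ∑-at : ∀ (h : Fin n → ℤ) v → ∑[ x < n ] (h x * δ 0F (d v x)) ≡ h v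
  ∑-at h v = trans
    (∑-single (λ x → h x * δ 0F (d v x)) v λ x x≢v →
      trans (cong (h x *_) (δ-≢ λ 0≡ → x≢v (≡-sym (d-zero (≡-sym 0≡))))) (ℤ.*-zeroʳ (h x)))
    (trans (cong (λ i → h v * δ 0F i) (d-refl v)) (ℤ.*-identityʳ (h v)))

  -- Write `β` at `d v x` as ∑ⱼ `β j * δ j (d v x)` and exchange the sums.
  ∑-by-distance : ∀ (h : Fin n → ℤ) (β : Fin 4 → ℤ) v →
    ∑[ x < n ] (h x * β (d v x)) ≡ ∑[ j < 4 ] (β j * ∑[ x < n ] (h x * δ j (d v x)))
  ∑-by-distance h β v = begin
    ∑[ x < n ] (h x * β (d v x))
      ≡⟨ ∑-cong (λ x → trans (cong (h x *_) (≡-sym (∑-δ β (d v x)))) (≡-sym (∑-* (h x) λ j → β j * δ j (d v x)))) ⟩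
    ∑[ x < n ] ∑[ j < 4 ] (h x * (β j * δ j (d v x)))
      ≡⟨ ∑-comm (λ x j → h x * (β j * δ j (d v x))) ⟩
    ∑[ j < 4 ] ∑[ x < n ] (h x * (β j * δ j (d v x)))
      ≡⟨ ∑-cong (λ j → trans (∑-cong λ x → swap (h x) (β j) _) (∑-* (β j) λ x → h x * δ j (d v x))) ⟩
    ∑[ j < 4 ] (β j * ∑[ x < n ] (h x * δ j (d v x))) ∎
    where
    swap : ∀ a b c → a * (b * c) ≡ b * (a * c)
    swap = solve-∀

  ∑-row : ∀ i (β : Fin 4 → ℤ) u v →
    ∑[ x < n ] (δ i (d u x) * β (d v x)) ≡ ∑[ j < 4 ] (β j * P (d u v) i j)
  ∑-row i β u v = trans (∑-by-distance (λ x → δ i (d u x)) β v)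
    (∑-cong λ j → cong (β j *_) (regular i j u v))

  valency : ∀ i u → ∑[ x < n ] δ i (d u x) ≡ P 0F i i
  valency i u = begin
    ∑[ x < n ] δ i (d u x)                   ≡⟨ ∑-cong (λ x → ≡-sym (δ-idem i (d u x))) ⟩
    ∑[ x < n ] (δ i (d u x) * δ i (d u x))   ≡⟨ regular i i u u ⟩
    P (d u u) i i                            ≡⟨ cong (λ h → P h i i) (d-refl u) ⟩
    P 0F i i                                 ∎

  row-sum : ∀ i u v → ∑[ j < 4 ] P (d u v) i j ≡ P 0F i i
  row-sum i u v = begin
    ∑[ j < 4 ] P (d u v) i j                 ≡⟨ ∑-cong (λ j → ≡-sym (ℤ.*-identityˡ (P (d u v) i j))) ⟩
    ∑[ j < 4 ] (1ℤ * P (d u v) i j)          ≡⟨ ≡-sym (∑-row i (λ _ → 1ℤ) u v) ⟩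
    ∑[ x < n ] (δ i (d u x) * 1ℤ)            ≡⟨ ∑-cong (λ x → ℤ.*-identityʳ (δ i (d u x))) ⟩
    ∑[ x < n ] δ i (d u x)                   ≡⟨ valency i u ⟩
    P 0F i i                                 ∎

  P-comm : ∀ i j u v → P (d u v) i j ≡ P (d u v) j i
  P-comm i j u v = begin
    P (d u v) i j                            ≡⟨ ≡-sym (regular i j u v) ⟩
    ∑[ x < n ] (δ i (d u x) * δ j (d v x))   ≡⟨ ∑-cong (λ x → ℤ.*-comm (δ i (d u x)) _) ⟩
    ∑[ x < n ] (δ j (d v x) * δ i (d u x))   ≡⟨ regular j i v u ⟩
    P (d v u) j i                            ≡⟨ cong (λ h → P h j i) (d-sym v u) ⟩
    P (d u v) j i                            ∎

  P-absent : ∀ i j u v → (∀ x → ¬ (d u x ≡ i × d v x ≡ j)) → P (d u v) i j ≡ 0ℤ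
  P-absent i j u v none = trans (≡-sym (regular i j u v)) (∑-zero vanish)
    where
    vanish : ∀ x → δ i (d u x) * δ j (d v x) ≡ 0ℤ
    vanish x with i Fin.≟ d u x | j Fin.≟ d v x
    ... | yes p | yes q = ⊥-elim (none x (≡-sym p , ≡-sym q))
    ... | yes _ | no  _ = refl
    ... | no  _ | yes _ = refl
    ... | no  _ | no  _ = refl

  -- A nonzero count has to yield an actual vertex; a decidable search over the finite vertex set
  -- finds it, and its failure would contradict `P-absent`.
  P-present : ∀ i j u v → P (d u v) i j ≢ 0ℤ → ∃[ x ] (d u x ≡ i × d v x ≡ j)
  P-present i j u v P≢0 with Fin.any? (λ x → d u x Fin.≟ i ×-dec d v x Fin.≟ j)
  ... | yes found = found
  ... | no  none  = ⊥-elim (P≢0 (P-absent i j u v λ x q → none (x , q)))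

  P-zeroʳ : ∀ i u v → P (d u v) i 0F ≡ δ i (d u v)
  P-zeroʳ i u v = trans (≡-sym (regular i 0F u v)) (∑-at (λ x → δ i (d u x)) v)

  -- Counts the pairs (x, y) with d(u,x) = i, d(x,y) = l, d(u,y) = j in two orders, which gives the
  -- familiar kᵢ pⁱₗⱼ = kⱼ pʲₗᵢ. The argument of type `Fin n` is the base vertex u.
  double-counting : ∀ i j l → Fin n → P 0F i i * P i l j ≡ P 0F j j * P j l i
  double-counting i j l u = begin
    P 0F i i * P i l j
      ≡⟨ ≡-sym (expand i j) ⟩
    ∑[ x < n ] ∑[ y < n ] (δ i (d u x) * (δ l (d x y) * δ j (d u y)))
      ≡⟨ ∑-comm (λ x y → δ i (d u x) * (δ l (d x y) * δ j (d u y))) ⟩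
    ∑[ y < n ] ∑[ x < n ] (δ i (d u x) * (δ l (d x y) * δ j (d u y)))
      ≡⟨ ∑-cong (λ y → ∑-cong λ x → trans
           (cong (λ h → δ i (d u x) * (δ l h * δ j (d u y))) (d-sym x y))
           (rotate (δ i (d u x)) (δ l (d y x)) (δ j (d u y)))) ⟩
    ∑[ y < n ] ∑[ x < n ] (δ j (d u y) * (δ l (d y x) * δ i (d u x)))
      ≡⟨ expand j i ⟩
    P 0F j j * P j l i ∎
    where
    rotate : ∀ a b c → a * (b * c) ≡ c * (b * a)
    rotate = solve-∀

    expand : ∀ i j → ∑[ x < n ] ∑[ y < n ] (δ i (d u x) * (δ l (d x y) * δ j (d u y))) ≡ P 0F i i * P i l j
    expand i j = begin
      ∑[ x < n ] ∑[ y < n ] (δ i (d u x) * (δ l (d x y) * δ j (d u y)))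
        ≡⟨ ∑-cong (λ x → trans (∑-* (δ i (d u x)) (λ y → δ l (d x y) * δ j (d u y)))
             (cong (δ i (d u x) *_) (trans (regular l j x u) (cong (λ h → P h l j) (d-sym x u))))) ⟩
      ∑[ x < n ] (δ i (d u x) * P (d u x) l j)
        ≡⟨ ∑-cong (λ x → trans (δ-* i (d u x) (λ h → P h l j)) (ℤ.*-comm (δ i (d u x)) _)) ⟩
      ∑[ x < n ] (P i l j * δ i (d u x))
        ≡⟨ ∑-* (P i l j) (λ x → δ i (d u x)) ⟩
      P i l j * ∑[ x < n ] δ i (d u x)
        ≡⟨ trans (cong (P i l j *_) (valency i u)) (ℤ.*-comm (P i l j) _) ⟩
      P 0F i i * P i l j ∎

  -- Associativity of the product AᵢAⱼAₗ of distance matrices, read off at the entry (u, v): both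
  -- sides count the sequences u, x, y, v with successive distances i, j, l, grouped by x on the
  -- left and by y on the right.
  P-assoc : ∀ i j l u v → ∑[ h < 4 ] (P h j l * P (d u v) i h) ≡ ∑[ h < 4 ] (P h i j * P (d v u) l h)
  P-assoc i j l u v = begin
    ∑[ h < 4 ] (P h j l * P (d u v) i h)
      ≡⟨ ≡-sym (∑-row i (λ h → P h j l) u v) ⟩
    ∑[ x < n ] (δ i (d u x) * P (d v x) j l)
      ≡⟨ ∑-cong (λ x → trans
           (cong (δ i (d u x) *_) (trans (cong (λ h → P h j l) (d-sym v x)) (≡-sym (regular j l x v))))
           (≡-sym (∑-* (δ i (d u x)) λ y → δ j (d x y) * δ l (d v y)))) ⟩
    ∑[ x < n ] ∑[ y < n ] (δ i (d u x) * (δ j (d x y) * δ l (d v y)))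
      ≡⟨ ∑-comm (λ x y → δ i (d u x) * (δ j (d x y) * δ l (d v y))) ⟩
    ∑[ y < n ] ∑[ x < n ] (δ i (d u x) * (δ j (d x y) * δ l (d v y)))
      ≡⟨ ∑-cong (λ y → trans
           (∑-cong λ x → trans
             (cong (λ h → δ i (d u x) * (δ j h * δ l (d v y))) (d-sym x y))
             (rotate (δ i (d u x)) (δ j (d y x)) (δ l (d v y))))
           (trans (∑-* (δ l (d v y)) λ x → δ i (d u x) * δ j (d y x))
             (cong (δ l (d v y) *_) (regular i j u y)))) ⟩
    ∑[ y < n ] (δ l (d v y) * P (d u y) i j)
      ≡⟨ ∑-row l (λ h → P h i j) v u ⟩
    ∑[ h < 4 ] (P h i j * P (d v u) l h) ∎
    where
    rotate : ∀ a b c → a * (b * c) ≡ c * (a * b)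
    rotate = solve-∀

-- Intersection numbers forced by the array.

module Parameters {n : ℕ} (S : DistanceScheme n) (a p c : ℤ) (0<a : 0ℤ ℤ.< a) (0<p : 0ℤ ℤ.< p)
  (P011 : DistanceScheme.P S 0F 1F 1F ≡ a ℤ.* (p ℤ.+ 1ℤ)) (P112 : DistanceScheme.P S 1F 1F 2F ≡ (a ℤ.+ 1ℤ) ℤ.* p)
  (P213 : DistanceScheme.P S 2F 1F 3F ≡ c) (P211 : DistanceScheme.P S 2F 1F 1F ≡ c) (P312 : DistanceScheme.P S 3F 1F 2F ≡ a ℤ.* p)
  {u₀ v₀ : Fin n} (d₃ : DistanceScheme.d S u₀ v₀ ≡ 3F) where
  open import Data.Integer using (_+_; _*_; _-_; _<_)
  open IntegerSums
  open Counting S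
  open ≡-Reasoning

  -- `P h` is tied to actual counts only when some pair of vertices is at distance `h`; hence these
  -- variants take such a pair as evidence.
  sum-at : ∀ {h u v} i → d u v ≡ h → ∑[ j < 4 ] P h i j ≡ P 0F i i
  sum-at {u = u} {v} i refl = row-sum i u v

  comm-at : ∀ {h u v} i j → d u v ≡ h → P h i j ≡ P h j i
  comm-at {u = u} {v} i j refl = P-comm i j u v

  zero-at : ∀ {h u v} i → d u v ≡ h → P h i 0F ≡ δ i h
  zero-at {u = u} {v} i refl = P-zeroʳ i u v

  triangle-at : ∀ {h u v} i j → d u v ≡ h → ¬ (toℕ h ℕ.≤ toℕ i ℕ.+ toℕ j × toℕ j ℕ.≤ toℕ h ℕ.+ toℕ i) → P h i j ≡ 0ℤ
  triangle-at {u = u} {v} i j refl far = P-absent i j u v λ where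
    x (refl , refl) → far (triangle u x v , subst (λ h → toℕ (d v x) ℕ.≤ toℕ h ℕ.+ toℕ (d u x)) (d-sym v u)
      (subst (λ h → toℕ (d v x) ℕ.≤ toℕ (d v u) ℕ.+ toℕ h) (d-sym x u) (triangle v u x)))

  diagonal-at : ∀ {u} i j → i ≢ j → P 0F i j ≡ 0ℤ
  diagonal-at {u} i j i≢j = trans (cong (λ h → P h i j) (≡-sym (d-refl u)))
    (P-absent i j u u λ where x (refl , refl) → i≢j refl)

  -- c₃ = ap is positive, so from the given pair at distance 3 one obtains a pair at distance 1.
  neighbour : ∃[ x ] (d u₀ x ≡ 1F × d v₀ x ≡ 2F)
  neighbour = P-present 1F 2F u₀ v₀ λ P≡0 → ℤ.<-irrefl
    (≡-sym (trans (≡-sym P312) (trans (cong (λ h → P h 1F 2F) (≡-sym d₃)) P≡0))) (0<* 0<a 0<p)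

  edge : d u₀ (proj₁ neighbour) ≡ 1F
  edge = proj₁ (proj₂ neighbour)

  k₃ : ℤ
  k₃ = (p + + 1) * (a + + 1)

  P113 : P 1F 1F 3F ≡ + 0
  P113 = triangle-at 1F 3F edge λ where (_ , ℕ.s≤s (ℕ.s≤s ()))

  P111 : P 1F 1F 1F ≡ a - p - + 1
  P111 = trans (entry₁ (sum-at 1F edge) P011 (zero-at 1F edge) P112 P113) (identity a p)
    where
    identity : ∀ a p → a * (p + + 1) - + 1 - (a + + 1) * p - + 0 ≡ a - p - + 1
    identity = solve-∀

  P311 : P 3F 1F 1F ≡ + 0
  P311 = triangle-at 1F 1F d₃ λ where (ℕ.s≤s (ℕ.s≤s ()) , _)

  P313 : P 3F 1F 3F ≡ a
  P313 = trans (entry₃ (sum-at 1F d₃) P011 (zero-at 1F d₃) P311 P312) (identity a p)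
    where
    identity : ∀ a p → a * (p + + 1) - + 0 - + 0 - a * p ≡ a
    identity = solve-∀

  P331 : P 3F 3F 1F ≡ a
  P331 = trans (comm-at 3F 1F d₃) P313

  k₂c : P 0F 2F 2F * c ≡ P 0F 3F 3F * (a * p)
  k₂c = begin
    P 0F 2F 2F * c            ≡⟨ cong (P 0F 2F 2F *_) (≡-sym P213) ⟩
    P 0F 2F 2F * P 2F 1F 3F   ≡⟨ double-counting 2F 3F 1F u₀ ⟩
    P 0F 3F 3F * P 3F 1F 2F   ≡⟨ cong (P 0F 3F 3F *_) P312 ⟩
    P 0F 3F 3F * (a * p)      ∎

  -- Since b₂ = c₂ = c, one has k₁b₁ = k₂c₂ = k₂b₂ = k₃c₃, so k₃ follows without computing k₂.
  P033 : P 0F 3F 3F ≡ k₃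
  P033 = cancelˡ (0<* 0<a 0<p) (begin
    a * p * P 0F 3F 3F                   ≡⟨ ℤ.*-comm (a * p) _ ⟩
    P 0F 3F 3F * (a * p)                 ≡⟨ ≡-sym k₂c ⟩
    P 0F 2F 2F * c                       ≡⟨ cong (P 0F 2F 2F *_) (≡-sym P211) ⟩
    P 0F 2F 2F * P 2F 1F 1F              ≡⟨ ≡-sym (double-counting 1F 2F 1F u₀) ⟩
    P 0F 1F 1F * P 1F 1F 2F              ≡⟨ cong₂ _*_ P011 P112 ⟩
    a * (p + + 1) * ((a + + 1) * p)      ≡⟨ identity a p ⟩
    a * p * k₃                           ∎)
    where
    identity : ∀ a p → a * (p + + 1) * ((a + + 1) * p) ≡ a * p * ((p + + 1) * (a + + 1))
    identity = solve-∀

  P133 : P 1F 3F 3F ≡ a + + 1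
  P133 = cancelˡ (0<* 0<a (0<+1 0<p)) (begin
    a * (p + + 1) * P 1F 3F 3F   ≡⟨ cong (_* P 1F 3F 3F) (≡-sym P011) ⟩
    P 0F 1F 1F * P 1F 3F 3F      ≡⟨ double-counting 1F 3F 3F u₀ ⟩
    P 0F 3F 3F * P 3F 3F 1F      ≡⟨ cong₂ _*_ P033 P331 ⟩
    k₃ * a                       ≡⟨ identity a p ⟩
    a * (p + + 1) * (a + + 1)    ∎)
    where
    identity : ∀ a p → (p + + 1) * (a + + 1) * a ≡ a * (p + + 1) * (a + + 1)
    identity = solve-∀

  P131 : P 1F 3F 1F ≡ + 0
  P131 = trans (comm-at 3F 1F edge) P113

  P132 : P 1F 3F 2F ≡ (a + + 1) * p
  P132 = trans (entry₂ (sum-at 3F edge) P033 (zero-at 3F edge) P131 P133) (identity a p)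
    where
    identity : ∀ a p → (p + + 1) * (a + + 1) - + 0 - + 0 - (a + + 1) ≡ (a + + 1) * p
    identity = solve-∀

  -- Compare the entries of A₁(A₃A₃) = (A₁A₃)A₃ at two adjacent vertices.
  P233 : P 2F 3F 3F ≡ c
  P233 = cancelˡ (0<* (0<+1 0<a) 0<p) (begin
    (a + + 1) * p * P 2F 3F 3F
      ≡⟨ identityˡ a p (P 2F 3F 3F) (P 3F 3F 3F) ⟩
    k₃ * + 1 + ((a + + 1) * (a - p - + 1) + (P 2F 3F 3F * ((a + + 1) * p) + (P 3F 3F 3F * + 0 + + 0)))
      - (a + + 1) * a
      ≡⟨ cong (_- (a + + 1) * a) (begin
          k₃ * + 1 + ((a + + 1) * (a - p - + 1) + (P 2F 3F 3F * ((a + + 1) * p) + (P 3F 3F 3F * + 0 + + 0)))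
            ≡⟨ ≡-sym (sum4 (cong₂ _*_ P033 (zero-at 1F edge)) (cong₂ _*_ P133 P111)
                 (cong (P 2F 3F 3F *_) P112) (cong (P 3F 3F 3F *_) P113)) ⟩
          ∑[ h < 4 ] (P h 3F 3F * P 1F 1F h)
            ≡⟨ subst₂ (λ h h′ → ∑[ i < 4 ] (P i 3F 3F * P h 1F i) ≡ ∑[ i < 4 ] (P i 1F 3F * P h′ 3F i))
                 edge (trans (d-sym _ _) edge) (P-assoc 1F 3F 3F u₀ (proj₁ neighbour)) ⟩
          ∑[ h < 4 ] (P h 1F 3F * P 1F 3F h)
            ≡⟨ sum4 (cong (P 0F 1F 3F *_) (zero-at 3F edge)) (cong₂ _*_ P113 P131)
                 (cong₂ _*_ P213 P132) (cong₂ _*_ P313 P133) ⟩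
          P 0F 1F 3F * + 0 + (+ 0 * + 0 + (c * ((a + + 1) * p) + (a * (a + + 1) + + 0))) ∎) ⟩
    P 0F 1F 3F * + 0 + (+ 0 * + 0 + (c * ((a + + 1) * p) + (a * (a + + 1) + + 0))) - (a + + 1) * a
      ≡⟨ identityʳ a p c (P 0F 1F 3F) ⟩
    (a + + 1) * p * c ∎)
    where
    sum4 : ∀ {x₀ x₁ x₂ x₃ y₀ y₁ y₂ y₃} → x₀ ≡ y₀ → x₁ ≡ y₁ → x₂ ≡ y₂ → x₃ ≡ y₃ →
      x₀ + (x₁ + (x₂ + (x₃ + 0ℤ))) ≡ y₀ + (y₁ + (y₂ + (y₃ + + 0)))
    sum4 refl refl refl refl = refl

    identityˡ : ∀ a p x y → (a + + 1) * p * x ≡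
      (p + + 1) * (a + + 1) * + 1 + ((a + + 1) * (a - p - + 1) + (x * ((a + + 1) * p) + (y * + 0 + + 0))) - (a + + 1) * a
    identityˡ = solve-∀

    identityʳ : ∀ a p c y →
      y * + 0 + (+ 0 * + 0 + (c * ((a + + 1) * p) + (a * (a + + 1) + + 0))) - (a + + 1) * a ≡ (a + + 1) * p * c
    identityʳ = solve-∀

  -- Again k₂ is bypassed: k₃p³₃₂ = k₂p²₃₃ = k₂c = k₃ap, the last equality being `k₂c`.
  P332 : P 3F 3F 2F ≡ a * p
  P332 = cancelˡ (0<* (0<+1 0<p) (0<+1 0<a)) (begin
    k₃ * P 3F 3F 2F           ≡⟨ cong (_* P 3F 3F 2F) (≡-sym P033) ⟩
    P 0F 3F 3F * P 3F 3F 2F   ≡⟨ ≡-sym (double-counting 2F 3F 3F u₀) ⟩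
    P 0F 2F 2F * P 2F 3F 3F   ≡⟨ cong (P 0F 2F 2F *_) P233 ⟩
    P 0F 2F 2F * c            ≡⟨ k₂c ⟩
    P 0F 3F 3F * (a * p)      ≡⟨ cong (_* (a * p)) P033 ⟩
    k₃ * (a * p)              ∎)

  P333 : P 3F 3F 3F ≡ p
  P333 = trans (entry₃ (sum-at 3F d₃) P033 (zero-at 3F d₃) P331 P332) (identity a p)
    where
    identity : ∀ a p → (p + + 1) * (a + + 1) - + 1 - a - a * p ≡ p
    identity = solve-∀

  -- The matrices of the numbers pʰ₁ⱼ and pʰ₃ⱼ. The entries at (2, 2) keep the unsimplified shape
  -- that `entry₂` produces.
  row₁ row₃ : Fin 4 → Fin 4 → ℤ
  row₁ 0F 1F = a * (p + + 1)
  row₁ 0F _  = + 0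
  row₁ 1F 0F = + 1
  row₁ 1F 1F = a - p - + 1
  row₁ 1F 2F = (a + + 1) * p
  row₁ 1F 3F = + 0
  row₁ 2F 0F = + 0
  row₁ 2F 1F = c
  row₁ 2F 2F = a * (p + + 1) - + 0 - c - c
  row₁ 2F 3F = c
  row₁ 3F 0F = + 0
  row₁ 3F 1F = + 0
  row₁ 3F 2F = a * p
  row₁ 3F 3F = a

  row₃ 0F 3F = k₃
  row₃ 0F _  = + 0
  row₃ 1F 0F = + 0
  row₃ 1F 1F = + 0
  row₃ 1F 2F = (a + + 1) * p
  row₃ 1F 3F = a + + 1
  row₃ 2F 0F = + 0
  row₃ 2F 1F = c
  row₃ 2F 2F = k₃ - + 0 - c - c
  row₃ 2F 3F = c
  row₃ 3F 0F = + 1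
  row₃ 3F 1F = a
  row₃ 3F 2F = a * p
  row₃ 3F 3F = p

  P-row₁ : ∀ {u v} h → d u v ≡ h → ∀ j → P h 1F j ≡ row₁ h j
  P-row₁ {u} 0F e 0F = diagonal-at {u} 1F 0F λ ()
  P-row₁     0F e 1F = P011
  P-row₁ {u} 0F e 2F = diagonal-at {u} 1F 2F λ ()
  P-row₁ {u} 0F e 3F = diagonal-at {u} 1F 3F λ ()
  P-row₁ 1F e 0F = zero-at 1F e
  P-row₁ 1F e 1F = P111
  P-row₁ 1F e 2F = P112
  P-row₁ 1F e 3F = P113
  P-row₁ 2F e 0F = zero-at 1F e
  P-row₁ 2F e 1F = P211
  P-row₁ 2F e 2F = entry₂ (sum-at 1F e) P011 (zero-at 1F e) P211 P213
  P-row₁ 2F e 3F = P213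
  P-row₁ 3F e 0F = zero-at 1F e
  P-row₁ 3F e 1F = P311
  P-row₁ 3F e 2F = P312
  P-row₁ 3F e 3F = P313

  P-row₃ : ∀ {u v} h → d u v ≡ h → ∀ j → P h 3F j ≡ row₃ h j
  P-row₃ {u} 0F e 0F = diagonal-at {u} 3F 0F λ ()
  P-row₃ {u} 0F e 1F = diagonal-at {u} 3F 1F λ ()
  P-row₃ {u} 0F e 2F = diagonal-at {u} 3F 2F λ ()
  P-row₃     0F e 3F = P033
  P-row₃ 1F e 0F = zero-at 3F e
  P-row₃ 1F e 1F = P131
  P-row₃ 1F e 2F = P132
  P-row₃ 1F e 3F = P133
  P-row₃ 2F e 0F = zero-at 3F e
  P-row₃ 2F e 1F = trans (comm-at 3F 1F e) P213
  P-row₃ 2F e 2F = entry₂ (sum-at 3F e) P033 (zero-at 3F e) (trans (comm-at 3F 1F e) P213) P233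
  P-row₃ 2F e 3F = P233
  P-row₃ 3F e 0F = zero-at 3F e
  P-row₃ 3F e 1F = P331
  P-row₃ 3F e 2F = P332
  P-row₃ 3F e 3F = P333

  -- To be applied with `α` equal to `f` or its square, which vanish at distance 2; so only the rows
  -- for distances 1 and 3 are needed, distance 0 contributing the single term x = u.
  ∑-weighted : ∀ (α β : Fin 4 → ℤ) → α 2F ≡ 0ℤ → ∀ u v →
    ∑[ x < n ] (α (d u x) * β (d v x)) ≡
      α 0F * β (d u v) + α 1F * ∑[ j < 4 ] (β j * row₁ (d u v) j) + α 3F * ∑[ j < 4 ] (β j * row₃ (d u v) j)
  ∑-weighted α β α₂≡0 u v = begin
    ∑[ x < n ] (α (d u x) * β (d v x))
      ≡⟨ ∑-cong (λ x → ℤ.*-comm (α (d u x)) _) ⟩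
    ∑[ x < n ] (β (d v x) * α (d u x))
      ≡⟨ ∑-by-distance (λ x → β (d v x)) α u ⟩
    ∑[ i < 4 ] (α i * ∑[ x < n ] (β (d v x) * δ i (d u x)))
      ≡⟨ collect (trans (∑-at (λ x → β (d v x)) u) (cong β (d-sym v u)))
           (slice 1F row₁ P-row₁) α₂≡0 (slice 3F row₃ P-row₃) ⟩
    α 0F * β (d u v) + α 1F * ∑[ j < 4 ] (β j * row₁ (d u v) j) + α 3F * ∑[ j < 4 ] (β j * row₃ (d u v) j) ∎
    where
    slice : ∀ i (row : Fin 4 → Fin 4 → ℤ) → (∀ {u v} h → d u v ≡ h → ∀ j → P h i j ≡ row h j) →
      ∑[ x < n ] (β (d v x) * δ i (d u x)) ≡ ∑[ j < 4 ] (β j * row (d u v) j)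
    slice i row P-row = begin
      ∑[ x < n ] (β (d v x) * δ i (d u x))     ≡⟨ ∑-cong (λ x → ℤ.*-comm (β (d v x)) _) ⟩
      ∑[ x < n ] (δ i (d u x) * β (d v x))     ≡⟨ ∑-row i β u v ⟩
      ∑[ j < 4 ] (β j * P (d u v) i j)         ≡⟨ ∑-cong {4} (λ j → cong (β j *_) (P-row {u} {v} (d u v) refl j)) ⟩
      ∑[ j < 4 ] (β j * row (d u v) j)         ∎

    collect : ∀ {x₀ x₁ x₂ x₃ y₀ y₁ y₃} → x₀ ≡ y₀ → x₁ ≡ y₁ → α 2F ≡ 0ℤ → x₃ ≡ y₃ →
      α 0F * x₀ + (α 1F * x₁ + (α 2F * x₂ + (α 3F * x₃ + 0ℤ))) ≡ α 0F * y₀ + α 1F * y₁ + α 3F * y₃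
    collect {x₀} {x₁} {x₂} {x₃} refl refl α₂≡0 refl =
      trans (cong (λ z → α 0F * x₀ + (α 1F * x₁ + (z * x₂ + (α 3F * x₃ + 0ℤ)))) α₂≡0)
            (identity (α 0F) (α 1F) (α 3F) x₀ x₁ x₂ x₃)
      where
      identity : ∀ a b c x y z w → a * x + (b * y + (+ 0 * z + (c * w + + 0))) ≡ a * x + b * y + c * w
      identity = solve-∀

-- The vanishing Krein parameter and the resulting triple equations.

module Krein {n : ℕ} (S : DistanceScheme n) (r t : ℤ) (0<t : 0ℤ ℤ.< t) where
  open import Data.Integer using (_+_; _*_; -_; _-_)
  open IntegerSums
  open Counting S
  open ≡-Reasoning

  -- `M` is the scalar with F² = M F, where F is the matrix with entries `f (d u v)`; thus F is `M`
  -- times an idempotent.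
  a p c q M : ℤ
  a = (+ 2 * r + + 1) * (+ 4 * t - + 1)
  p = + 4 * r
  c = (r + t) * (+ 4 * r + + 1)
  q = + 2 * r + + 1
  M = + 8 * t * q

  -- f and g are multiples of the cosine sequences of the eigenvalues a and − (2r + 1)(4r + 1),
  -- φ is the part of g that matters (see g-decomposition), and e and ε are f and φ with the
  -- value at distance 0 removed.
  f g e φ ε sq : Fin 4 → ℤ
  f 0F = p + + 1
  f 1F = + 1
  f 2F = + 0
  f 3F = - (+ 1)

  g 0F = (+ 4 * t - + 1) * (+ 4 * r * t - r + + 2 * t)
  g 1F = - (+ 4 * r * t - r + + 2 * t)
  g 2F = r + t
  g 3F = - (r * (+ 4 * t - + 1))

  e 0F = + 0
  e 1F = + 1
  e 2F = + 0
  e 3F = - (+ 1)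

  sq i = f i * f i
  φ i = f i + + 2 * q * sq i
  ε i = e i + + 2 * q * (e i * e i)

  -- The value of `φ` at distance 0, where `f` equals `p + 1`.
  κ : ℤ
  κ = (p + + 1) + + 2 * q * ((p + + 1) * (p + + 1))

  -- In a sum of `f` times `f` times `g`, the constant part is evaluated by `∑ff` and the `δ 0F`
  -- part by a single vertex. Only `φ` leaves a genuine triple sum, and its coefficient - t can
  -- later be cancelled.
  g-decomposition : ∀ i → g i ≡ (r + t) + (- t * φ i + M * (t + + 2 * r * q) * δ 0F i)
  g-decomposition 0F = identity r t
    where
    identity : ∀ r t → let q = + 2 * r + + 1; f = + 4 * r + + 1 in
      (+ 4 * t - + 1) * (+ 4 * r * t - r + + 2 * t) ≡
      (r + t) + (- t * (f + + 2 * q * (f * f)) + + 8 * t * q * (t + + 2 * r * q) * + 1)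
    identity = solve-∀
  g-decomposition 1F = identity r t
    where
    identity : ∀ r t → let q = + 2 * r + + 1 in
      - (+ 4 * r * t - r + + 2 * t) ≡
      (r + t) + (- t * (+ 1 + + 2 * q * + 1) + + 8 * t * q * (t + + 2 * r * q) * + 0)
    identity = solve-∀
  g-decomposition 2F = identity r t
    where
    identity : ∀ r t → let q = + 2 * r + + 1 in
      r + t ≡ (r + t) + (- t * (+ 0 + + 2 * q * + 0) + + 8 * t * q * (t + + 2 * r * q) * + 0)
    identity = solve-∀
  g-decomposition 3F = identity r t
    where
    identity : ∀ r t → let q = + 2 * r + + 1 in
      - (r * (+ 4 * t - + 1)) ≡
      (r + t) + (- t * (- (+ 1) + + 2 * q * + 1) + + 8 * t * q * (t + + 2 * r * q) * + 0)
    identity = solve-∀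

  f-split : ∀ i → f i ≡ e i + (p + + 1) * δ 0F i
  f-split 0F = identity p
    where
    identity : ∀ p → p + + 1 ≡ + 0 + (p + + 1) * + 1
    identity = solve-∀
  f-split 1F = identity p
    where
    identity : ∀ p → + 1 ≡ + 1 + (p + + 1) * + 0
    identity = solve-∀
  f-split 2F = identity p
    where
    identity : ∀ p → + 0 ≡ + 0 + (p + + 1) * + 0
    identity = solve-∀
  f-split 3F = identity p
    where
    identity : ∀ p → - (+ 1) ≡ - (+ 1) + (p + + 1) * + 0
    identity = solve-∀

  φ-split : ∀ i → φ i ≡ ε i + κ * δ 0F i
  φ-split 0F = identity p q
    where
    identity : ∀ p q → (p + + 1) + + 2 * q * ((p + + 1) * (p + + 1)) ≡
      + 0 + + 2 * q * + 0 + ((p + + 1) + + 2 * q * ((p + + 1) * (p + + 1))) * + 1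
    identity = solve-∀
  φ-split 1F = ≡-sym (trans (cong (λ z → ε 1F + z) (ℤ.*-zeroʳ κ)) (ℤ.+-identityʳ (ε 1F)))
  φ-split 2F = ≡-sym (trans (cong (λ z → ε 2F + z) (ℤ.*-zeroʳ κ)) (ℤ.+-identityʳ (ε 2F)))
  φ-split 3F = ≡-sym (trans (cong (λ z → ε 3F + z) (ℤ.*-zeroʳ κ)) (ℤ.+-identityʳ (ε 3F)))

  -- Isolates the term x = u: `β` will be `α` with its value `m` at distance 0 replaced by 0.
  peel : ∀ (F : Fin n → ℤ) (α β : Fin 4 → ℤ) m → (∀ i → α i ≡ β i + m * δ 0F i) → ∀ u →
    ∑[ x < n ] (α (d u x) * F x) ≡ ∑[ x < n ] (β (d u x) * F x) + m * F u
  peel F α β m α-split u = begin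
    ∑[ x < n ] (α (d u x) * F x)
      ≡⟨ ∑-cong (λ x → trans (cong (_* F x) (α-split (d u x))) (identity (β (d u x)) m (δ 0F (d u x)) (F x))) ⟩
    ∑[ x < n ] (β (d u x) * F x + m * (F x * δ 0F (d u x)))
      ≡⟨ ∑-+ (λ x → β (d u x) * F x) (λ x → m * (F x * δ 0F (d u x))) ⟩
    ∑[ x < n ] (β (d u x) * F x) + ∑[ x < n ] (m * (F x * δ 0F (d u x)))
      ≡⟨ cong (λ z → ∑[ x < n ] (β (d u x) * F x) + z)
           (trans (∑-* m (λ x → F x * δ 0F (d u x))) (cong (m *_) (∑-at F u))) ⟩
    ∑[ x < n ] (β (d u x) * F x) + m * F u ∎
    where
    identity : ∀ b m z y → (b + m * z) * y ≡ b * y + m * (y * z)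
    identity = solve-∀

  -- The value of ∑ₓ ε(w,x) e(u,x) e(v,x) at the distances i = d(u,v), j = d(u,w), k = d(v,w):
  -- the right-hand side of krein minus the contributions of x = u, v, w to its left-hand side.
  R : Fin 4 → Fin 4 → Fin 4 → ℤ
  R i j k = + 8 * q * ((r + t) * f i + (t + + 2 * r * q) * (f j * f k))
    - (p + + 1) * (φ j * f i) - (p + + 1) * (e i * φ k) - κ * (e j * e k)

  module _
    (∑ff : ∀ u v → ∑[ x < n ] (f (d u x) * f (d v x)) ≡ M * f (d u v))
    (∑sqg : ∀ u v → ∑[ x < n ] (sq (d u x) * g (d v x)) ≡ 0ℤ) where

    -- F² = M F applied to the vector `h`, using the symmetry of F.
    project : ∀ (h : Fin n → ℤ) y →
      ∑[ v < n ] (f (d v y) * ∑[ x < n ] (f (d v x) * h x)) ≡ M * ∑[ x < n ] (f (d y x) * h x)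
    project h y = begin
      ∑[ v < n ] (f (d v y) * ∑[ x < n ] (f (d v x) * h x))
        ≡⟨ ∑-cong (λ v → ≡-sym (∑-* (f (d v y)) λ x → f (d v x) * h x)) ⟩
      ∑[ v < n ] ∑[ x < n ] (f (d v y) * (f (d v x) * h x))
        ≡⟨ ∑-comm (λ v x → f (d v y) * (f (d v x) * h x)) ⟩
      ∑[ x < n ] ∑[ v < n ] (f (d v y) * (f (d v x) * h x))
        ≡⟨ ∑-cong (λ x → trans (∑-cong λ v → trans
             (rotate (f (d v y)) (f (d v x)) (h x))
             (cong₂ (λ i j → h x * (f i * f j)) (d-sym v y) (d-sym v x)))
             (trans (∑-* (h x) λ v → f (d y v) * f (d x v)) (trans (cong (h x *_) (∑ff y x)) (shift (h x) M (f (d y x)))))) ⟩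
      ∑[ x < n ] (M * (f (d y x) * h x))
        ≡⟨ ∑-* M (λ x → f (d y x) * h x) ⟩
      M * ∑[ x < n ] (f (d y x) * h x) ∎
      where
      rotate : ∀ a b c → a * (b * c) ≡ c * (a * b)
      rotate = solve-∀

      shift : ∀ a b c → a * (b * c) ≡ b * (c * a)
      shift = solve-∀

    module _ (w : Fin n) where
      G : Fin n → ℤ
      G x = g (d w x)

      -- The matrix F D F, where D is the diagonal matrix with entries `G x`.
      K : Fin n → Fin n → ℤ
      K u v = ∑[ x < n ] (f (d u x) * (f (d v x) * G x))

      K-sym : ∀ u v → K u v ≡ ∑[ x < n ] (f (d v x) * (f (d u x) * G x))
      K-sym u v = ∑-cong λ x → swap (f (d u x)) (f (d v x)) (G x)
        where
        swap : ∀ a b c → a * (b * c) ≡ b * (a * c)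
        swap = solve-∀

      -- This is the diagonal entry of F K F at y. As K = F D F and F² = M F, it equals M² K(y,y),
      -- and K(y,y) = ∑ₓ f(y,x)² g(w,x) is zero by `∑sqg`.
      K-project : ∀ y → ∑[ u < n ] (f (d u y) * ∑[ v < n ] (f (d v y) * K u v)) ≡ 0ℤ
      K-project y = begin
        ∑[ u < n ] (f (d u y) * ∑[ v < n ] (f (d v y) * K u v))
          ≡⟨ ∑-cong (λ u → cong (f (d u y) *_) (inner u)) ⟩
        ∑[ u < n ] (f (d u y) * (M * ∑[ x < n ] (f (d u x) * (f (d y x) * G x))))
          ≡⟨ ∑-cong (λ u → swap (f (d u y)) M _) ⟩
        ∑[ u < n ] (M * (f (d u y) * ∑[ x < n ] (f (d u x) * (f (d y x) * G x))))
          ≡⟨ ∑-* M (λ u → f (d u y) * ∑[ x < n ] (f (d u x) * (f (d y x) * G x))) ⟩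
        M * ∑[ u < n ] (f (d u y) * ∑[ x < n ] (f (d u x) * (f (d y x) * G x)))
          ≡⟨ cong (M *_) (project (λ x → f (d y x) * G x) y) ⟩
        M * (M * ∑[ x < n ] (f (d y x) * (f (d y x) * G x)))
          ≡⟨ cong (λ z → M * (M * z)) (trans (∑-cong λ x → ≡-sym (ℤ.*-assoc (f (d y x)) (f (d y x)) (G x))) (∑sqg y w)) ⟩
        M * (M * 0ℤ)
          ≡⟨ trans (cong (M *_) (ℤ.*-zeroʳ M)) (ℤ.*-zeroʳ M) ⟩
        0ℤ ∎
        where
        swap : ∀ a b c → a * (b * c) ≡ b * (a * c)
        swap = solve-∀

        inner : ∀ u → ∑[ v < n ] (f (d v y) * K u v) ≡ M * ∑[ x < n ] (f (d u x) * (f (d y x) * G x))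
        inner u = begin
          ∑[ v < n ] (f (d v y) * K u v)
            ≡⟨ ∑-cong (λ v → cong (f (d v y) *_) (K-sym u v)) ⟩
          ∑[ v < n ] (f (d v y) * ∑[ x < n ] (f (d v x) * (f (d u x) * G x)))
            ≡⟨ project (λ x → f (d u x) * G x) y ⟩
          M * ∑[ x < n ] (f (d y x) * (f (d u x) * G x))
            ≡⟨ cong (M *_) (∑-cong λ x → swap (f (d y x)) (f (d u x)) (G x)) ⟩
          M * ∑[ x < n ] (f (d u x) * (f (d y x) * G x)) ∎

      -- Writing out one factor `K u v` as a sum over y turns the sum of squares into ∑ `G y` (F K
      -- F)(y,y), whose terms vanish by `K-project`.
      ∑K² : ∑[ u < n ] ∑[ v < n ] (K u v * K u v) ≡ 0ℤ
      ∑K² = begin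
        ∑[ u < n ] ∑[ v < n ] (K u v * K u v)
          ≡⟨ ∑-cong (λ u → ∑-cong λ v → ≡-sym (∑-* (K u v) λ y → f (d u y) * (f (d v y) * G y))) ⟩
        ∑[ u < n ] ∑[ v < n ] ∑[ y < n ] (K u v * (f (d u y) * (f (d v y) * G y)))
          ≡⟨ ∑-cong (λ u → ∑-comm λ v y → K u v * (f (d u y) * (f (d v y) * G y))) ⟩
        ∑[ u < n ] ∑[ y < n ] ∑[ v < n ] (K u v * (f (d u y) * (f (d v y) * G y)))
          ≡⟨ ∑-cong (λ u → ∑-cong λ y → trans
               (∑-cong λ v → shuffle (K u v) (f (d u y)) (f (d v y)) (G y))
               (trans (∑-* (G y * f (d u y)) λ v → f (d v y) * K u v) (ℤ.*-assoc (G y) (f (d u y)) _))) ⟩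
        ∑[ u < n ] ∑[ y < n ] (G y * (f (d u y) * ∑[ v < n ] (f (d v y) * K u v)))
          ≡⟨ ∑-comm (λ u y → G y * (f (d u y) * ∑[ v < n ] (f (d v y) * K u v))) ⟩
        ∑[ y < n ] ∑[ u < n ] (G y * (f (d u y) * ∑[ v < n ] (f (d v y) * K u v)))
          ≡⟨ ∑-zero (λ y → trans (∑-* (G y) λ u → f (d u y) * ∑[ v < n ] (f (d v y) * K u v))
               (trans (cong (G y *_) (K-project y)) (ℤ.*-zeroʳ (G y)))) ⟩
        0ℤ ∎
        where
        shuffle : ∀ k a b g → k * (a * (b * g)) ≡ g * a * (b * k)
        shuffle = solve-∀

      K≡0 : ∀ u v → K u v ≡ 0ℤ
      K≡0 u v = [ id , id ]′ (ℤ.i*j≡0⇒i≡0∨j≡0 (K u v) (∑-nonneg-zero _ (λ v → square-nonneg (K u v))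
        (∑-nonneg-zero _ (λ u → ∑-nonneg _ λ v → square-nonneg (K u v)) ∑K² u) v))

    -- The equation `K≡0` with `g` replaced by its decomposition; after the known parts are moved to
    -- the right, every term has the factor t.
    krein : ∀ u v w → ∑[ x < n ] (φ (d w x) * (f (d u x) * f (d v x))) ≡
      + 8 * q * ((r + t) * f (d u v) + (t + + 2 * r * q) * (f (d u w) * f (d v w)))
    krein u v w = cancelˡ 0<t (begin
      t * Φ
        ≡⟨ identity₁ t Φ ((r + t) * (M * f (d u v))) (μ * (f (d u w) * f (d v w))) ⟩
      (r + t) * (M * f (d u v)) + μ * (f (d u w) * f (d v w))
        - ((r + t) * (M * f (d u v)) + (- t * Φ + μ * (f (d u w) * f (d v w))))
        ≡⟨ cong (λ z → (r + t) * (M * f (d u v)) + μ * (f (d u w) * f (d v w)) - z)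
             (trans (≡-sym expand) (K≡0 w u v)) ⟩
      (r + t) * (M * f (d u v)) + μ * (f (d u w) * f (d v w)) - + 0
        ≡⟨ identity₂ r t q (f (d u v)) (f (d u w) * f (d v w)) ⟩
      t * (+ 8 * q * ((r + t) * f (d u v) + (t + + 2 * r * q) * (f (d u w) * f (d v w)))) ∎)
      where
      Φ μ : ℤ
      Φ = ∑[ x < n ] (φ (d w x) * (f (d u x) * f (d v x)))
      μ = M * (t + + 2 * r * q)

      identity₁ : ∀ t z a b → t * z ≡ a + b - (a + (- t * z + b))
      identity₁ = solve-∀

      identity₂ : ∀ r t q y z → (r + t) * (+ 8 * t * q * y) + + 8 * t * q * (t + + 2 * r * q) * z - + 0 ≡
        t * (+ 8 * q * ((r + t) * y + (t + + 2 * r * q) * z))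
      identity₂ = solve-∀

      distribute : ∀ s t μ a b y z → a * (b * (s + (- t * y + μ * z))) ≡
        s * (a * b) + (- t * (y * (a * b)) + μ * (a * b * z))
      distribute = solve-∀

      expand : K w u v ≡ (r + t) * (M * f (d u v)) + (- t * Φ + μ * (f (d u w) * f (d v w)))
      expand = begin
        K w u v
          ≡⟨ ∑-cong (λ x → trans (cong (λ z → f (d u x) * (f (d v x) * z)) (g-decomposition (d w x)))
               (distribute (r + t) t μ (f (d u x)) (f (d v x)) (φ (d w x)) (δ 0F (d w x)))) ⟩
        ∑[ x < n ] ((r + t) * (f (d u x) * f (d v x)) + (- t * (φ (d w x) * (f (d u x) * f (d v x))) + μ * (f (d u x) * f (d v x) * δ 0F (d w x))))
          ≡⟨ ∑-+ (λ x → (r + t) * (f (d u x) * f (d v x))) (λ x → - t * (φ (d w x) * (f (d u x) * f (d v x))) + μ * (f (d u x) * f (d v x) * δ 0F (d w x))) ⟩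
        ∑[ x < n ] ((r + t) * (f (d u x) * f (d v x))) + ∑[ x < n ] (- t * (φ (d w x) * (f (d u x) * f (d v x))) + μ * (f (d u x) * f (d v x) * δ 0F (d w x)))
          ≡⟨ cong₂ _+_
               (trans (∑-* (r + t) λ x → f (d u x) * f (d v x)) (cong ((r + t) *_) (∑ff u v)))
               (trans (∑-+ (λ x → - t * (φ (d w x) * (f (d u x) * f (d v x)))) (λ x → μ * (f (d u x) * f (d v x) * δ 0F (d w x))))
                 (cong₂ _+_ (∑-* (- t) λ x → φ (d w x) * (f (d u x) * f (d v x)))
                   (trans (∑-* μ λ x → f (d u x) * f (d v x) * δ 0F (d w x))
                     (cong (μ *_) (∑-at (λ x → f (d u x) * f (d v x)) w))))) ⟩
        (r + t) * (M * f (d u v)) + (- t * Φ + μ * (f (d u w) * f (d v w))) ∎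

    -- Three uses of `peel`, at u, v and w in turn, take the contributions of these vertices out of
    -- the sum in `krein`.
    krein° : ∀ {i j k u v w} → d u v ≡ i → d u w ≡ j → d v w ≡ k →
      ∑[ x < n ] (ε (d w x) * (e (d u x) * e (d v x))) ≡ R i j k
    krein° {u = u} {v} {w} refl refl refl = isolate
      (begin
        ∑[ x < n ] (φ (d w x) * (f (d u x) * f (d v x)))
          ≡⟨ ∑-cong (λ x → rotate (φ (d w x)) (f (d u x)) (f (d v x))) ⟩
        ∑[ x < n ] (f (d u x) * (φ (d w x) * f (d v x)))
          ≡⟨ peel (λ x → φ (d w x) * f (d v x)) f e (p + + 1) f-split u ⟩
        ∑[ x < n ] (e (d u x) * (φ (d w x) * f (d v x))) + (p + + 1) * (φ (d w u) * f (d v u))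
          ≡⟨ cong₂ _+_ (begin
               ∑[ x < n ] (e (d u x) * (φ (d w x) * f (d v x)))
                 ≡⟨ ∑-cong (λ x → rotate′ (e (d u x)) (φ (d w x)) (f (d v x))) ⟩
               ∑[ x < n ] (f (d v x) * (e (d u x) * φ (d w x)))
                 ≡⟨ peel (λ x → e (d u x) * φ (d w x)) f e (p + + 1) f-split v ⟩
               ∑[ x < n ] (e (d v x) * (e (d u x) * φ (d w x))) + (p + + 1) * (e (d u v) * φ (d w v))
                 ≡⟨ cong₂ _+_ (begin
                      ∑[ x < n ] (e (d v x) * (e (d u x) * φ (d w x)))
                        ≡⟨ ∑-cong (λ x → reverse (e (d v x)) (e (d u x)) (φ (d w x))) ⟩
                      ∑[ x < n ] (φ (d w x) * (e (d u x) * e (d v x)))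
                        ≡⟨ peel (λ x → e (d u x) * e (d v x)) φ ε κ φ-split w ⟩
                      ∑[ x < n ] (ε (d w x) * (e (d u x) * e (d v x))) + κ * (e (d u w) * e (d v w)) ∎)
                      (cong (λ i → (p + + 1) * (e (d u v) * φ i)) (d-sym w v)) ⟩
               ∑[ x < n ] (ε (d w x) * (e (d u x) * e (d v x))) + κ * (e (d u w) * e (d v w)) + (p + + 1) * (e (d u v) * φ (d v w)) ∎)
               (cong₂ (λ i j → (p + + 1) * (φ i * f j)) (d-sym w u) (d-sym v u)) ⟩
        ∑[ x < n ] (ε (d w x) * (e (d u x) * e (d v x))) + κ * (e (d u w) * e (d v w)) + (p + + 1) * (e (d u v) * φ (d v w))
          + (p + + 1) * (φ (d u w) * f (d u v)) ∎)
      (krein u v w)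
      where
      rotate : ∀ a b c → a * (b * c) ≡ b * (a * c)
      rotate = solve-∀

      rotate′ : ∀ a b c → a * (b * c) ≡ c * (a * b)
      rotate′ = solve-∀

      reverse : ∀ a b c → a * (b * c) ≡ c * (b * a)
      reverse = solve-∀

      isolate : ∀ {y s z₁ z₂ z₃ b} → y ≡ s + z₁ + z₂ + z₃ → y ≡ b → s ≡ b - z₃ - z₂ - z₁
      isolate {s = s} {z₁} {z₂} {z₃} refl refl = identity s z₁ z₂ z₃
        where
        identity : ∀ s z₁ z₂ z₃ → s ≡ s + z₁ + z₂ + z₃ - z₃ - z₂ - z₁
        identity = solve-∀

-- The eigenvector identities for the given array.

module Nonexistence {n : ℕ} (S : DistanceScheme n) (r t : ℤ) (0<r : 0ℤ ℤ.< r) (0<t : 0ℤ ℤ.< t) where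
  open import Data.Integer using (_+_; _*_; -_; _-_; _≤_; _<_)
  open IntegerSums
  open Counting S
  open Krein S r t 0<t
  open ≡-Reasoning

  module _ (0<a : 0ℤ < a)
    (P011 : P 0F 1F 1F ≡ a * (p + + 1)) (P112 : P 1F 1F 2F ≡ (a + + 1) * p)
    (P213 : P 2F 1F 3F ≡ c) (P211 : P 2F 1F 1F ≡ c) (P312 : P 3F 1F 2F ≡ a * p)
    {u₀ v₀ : Fin n} (d₃ : d u₀ v₀ ≡ 3F) where

    0<p : 0ℤ < p
    0<p = 0<* {+ 4} {r} (ℤ.+<+ (ℕ.s≤s ℕ.z≤n)) 0<r

    open Parameters S a p c 0<a 0<p P011 P112 P213 P211 P312 d₃

    -- The entries of F² = M F, one polynomial identity in r and t for each distance (with c free at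
    -- distance 2).
    ff : ∀ h → f 0F * f h + f 1F * ∑[ j < 4 ] (f j * row₁ h j) + f 3F * ∑[ j < 4 ] (f j * row₃ h j) ≡ M * f h
    ff 0F = identity r t
      where
      identity : ∀ r t → let
          p = + 4 * r
          a = (+ 2 * r + + 1) * (+ 4 * t - + 1) in
        (p + + 1) * (p + + 1)
        + + 1 * ((p + + 1) * + 0 + (+ 1 * (a * (p + + 1)) + (+ 0 * + 0 + (- (+ 1) * + 0 + + 0))))
        + - (+ 1) * ((p + + 1) * + 0 + (+ 1 * + 0 + (+ 0 * + 0 + (- (+ 1) * ((p + + 1) * (a + + 1)) + + 0))))
        ≡ + 8 * t * (+ 2 * r + + 1) * (p + + 1)
      identity = solve-∀
    ff 1F = identity r t
      where
      identity : ∀ r t → let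
          p = + 4 * r
          a = (+ 2 * r + + 1) * (+ 4 * t - + 1) in
        (p + + 1) * + 1
        + + 1 * ((p + + 1) * + 1 + (+ 1 * (a - p - + 1) + (+ 0 * ((a + + 1) * p) + (- (+ 1) * + 0 + + 0))))
        + - (+ 1) * ((p + + 1) * + 0 + (+ 1 * + 0 + (+ 0 * ((a + + 1) * p) + (- (+ 1) * (a + + 1) + + 0))))
        ≡ + 8 * t * (+ 2 * r + + 1) * + 1
      identity = solve-∀
    ff 2F = identity r t c
      where
      identity : ∀ r t c → let
          p = + 4 * r
          a = (+ 2 * r + + 1) * (+ 4 * t - + 1) in
        (p + + 1) * + 0
        + + 1 * ((p + + 1) * + 0 + (+ 1 * c + (+ 0 * (a * (p + + 1) - + 0 - c - c) + (- (+ 1) * c + + 0))))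
        + - (+ 1) * ((p + + 1) * + 0 + (+ 1 * c + (+ 0 * (((p + + 1) * (a + + 1)) - + 0 - c - c) + (- (+ 1) * c + + 0))))
        ≡ + 8 * t * (+ 2 * r + + 1) * + 0
      identity = solve-∀
    ff 3F = identity r t
      where
      identity : ∀ r t → let
          p = + 4 * r
          a = (+ 2 * r + + 1) * (+ 4 * t - + 1) in
        (p + + 1) * - (+ 1)
        + + 1 * ((p + + 1) * + 0 + (+ 1 * + 0 + (+ 0 * (a * p) + (- (+ 1) * a + + 0))))
        + - (+ 1) * ((p + + 1) * + 1 + (+ 1 * a + (+ 0 * (a * p) + (- (+ 1) * p + + 0))))
        ≡ + 8 * t * (+ 2 * r + + 1) * - (+ 1)
      identity = solve-∀

    -- The vanishing of the Krein parameter: the entrywise square of F times the matrix of `g` is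
    -- zero, checked at each distance. At distance 2 the exact value c = (r + t)(4r + 1) enters.
    sqg : ∀ h → sq 0F * g h + sq 1F * ∑[ j < 4 ] (g j * row₁ h j) + sq 3F * ∑[ j < 4 ] (g j * row₃ h j) ≡ 0ℤ
    sqg 0F = identity r t
      where
      identity : ∀ r t → let
          p = + 4 * r
          a = (+ 2 * r + + 1) * (+ 4 * t - + 1)
          g₀ = (+ 4 * t - + 1) * (+ 4 * r * t - r + + 2 * t)
          g₁ = - (+ 4 * r * t - r + + 2 * t)
          g₂ = r + t
          g₃ = - (r * (+ 4 * t - + 1)) in
        ((p + + 1) * (p + + 1)) * g₀
        + + 1 * (g₀ * + 0 + (g₁ * (a * (p + + 1)) + (g₂ * + 0 + (g₃ * + 0 + + 0))))
        + + 1 * (g₀ * + 0 + (g₁ * + 0 + (g₂ * + 0 + (g₃ * ((p + + 1) * (a + + 1)) + + 0))))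
        ≡ + 0
      identity = solve-∀
    sqg 1F = identity r t
      where
      identity : ∀ r t → let
          p = + 4 * r
          a = (+ 2 * r + + 1) * (+ 4 * t - + 1)
          g₀ = (+ 4 * t - + 1) * (+ 4 * r * t - r + + 2 * t)
          g₁ = - (+ 4 * r * t - r + + 2 * t)
          g₂ = r + t
          g₃ = - (r * (+ 4 * t - + 1)) in
        ((p + + 1) * (p + + 1)) * g₁
        + + 1 * (g₀ * + 1 + (g₁ * (a - p - + 1) + (g₂ * ((a + + 1) * p) + (g₃ * + 0 + + 0))))
        + + 1 * (g₀ * + 0 + (g₁ * + 0 + (g₂ * ((a + + 1) * p) + (g₃ * (a + + 1) + + 0))))
        ≡ + 0
      identity = solve-∀
    sqg 2F = identity r t
      where
      identity : ∀ r t → let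
          p = + 4 * r
          a = (+ 2 * r + + 1) * (+ 4 * t - + 1)
          g₀ = (+ 4 * t - + 1) * (+ 4 * r * t - r + + 2 * t)
          g₁ = - (+ 4 * r * t - r + + 2 * t)
          g₂ = r + t
          g₃ = - (r * (+ 4 * t - + 1))
          c = (r + t) * (+ 4 * r + + 1) in
        ((p + + 1) * (p + + 1)) * g₂
        + + 1 * (g₀ * + 0 + (g₁ * c + (g₂ * (a * (p + + 1) - + 0 - c - c) + (g₃ * c + + 0))))
        + + 1 * (g₀ * + 0 + (g₁ * c + (g₂ * (((p + + 1) * (a + + 1)) - + 0 - c - c) + (g₃ * c + + 0))))
        ≡ + 0
      identity = solve-∀
    sqg 3F = identity r t
      where
      identity : ∀ r t → let
          p = + 4 * r
          a = (+ 2 * r + + 1) * (+ 4 * t - + 1)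
          g₀ = (+ 4 * t - + 1) * (+ 4 * r * t - r + + 2 * t)
          g₁ = - (+ 4 * r * t - r + + 2 * t)
          g₂ = r + t
          g₃ = - (r * (+ 4 * t - + 1)) in
        ((p + + 1) * (p + + 1)) * g₃
        + + 1 * (g₀ * + 0 + (g₁ * + 0 + (g₂ * (a * p) + (g₃ * a + + 0))))
        + + 1 * (g₀ * + 1 + (g₁ * a + (g₂ * (a * p) + (g₃ * p + + 0))))
        ≡ + 0
      identity = solve-∀

    ∑ff : ∀ u v → ∑[ x < n ] (f (d u x) * f (d v x)) ≡ M * f (d u v)
    ∑ff u v = trans (∑-weighted f f refl u v) (ff (d u v))

    ∑sqg : ∀ u v → ∑[ x < n ] (sq (d u x) * g (d v x)) ≡ 0ℤ
    ∑sqg u v = trans (∑-weighted sq g refl u v) (sqg (d u v))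

    three-apart : ∀ {u v} → d u v ≡ 3F → ∀ x → 3 ℕ.≤ toℕ (d u x) ℕ.+ toℕ (d v x)
    three-apart {u} {v} uv x = subst (λ h → toℕ h ℕ.≤ toℕ (d u x) ℕ.+ toℕ (d v x)) uv (triangle u x v)

    TripleWeight : Set
    TripleWeight = Fin 4 → Fin 4 → Fin 4 → ℤ

    -- Summed over all vertices x, this indicator gives the number [ijk] for the indices in the
    -- brackets.
    ⟨_,_,_⟩ : Fin 4 → Fin 4 → Fin 4 → TripleWeight
    ⟨ i′ , j′ , k′ ⟩ i j k = δ i′ i * (δ j′ j * δ k′ k)

    at : ∀ (Q : TripleWeight) {i j k i′ j′ k′} → i ≡ i′ → j ≡ j′ → k ≡ k′ → Q i j k ≡ 0ℤ → Q i′ j′ k′ ≡ 0ℤ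
    at Q refl refl refl z = z

    indicator-nonneg : ∀ i′ j′ k′ i j k → 0ℤ ≤ ⟨ i′ , j′ , k′ ⟩ i j k
    indicator-nonneg i′ j′ k′ i j k =
      nonneg-product (δ-nonneg i′ i) (nonneg-product (δ-nonneg j′ j) (δ-nonneg k′ k))

    -- Three vertices pairwise at distance 3.

    module Clique {u v w : Fin n} (uv : d u v ≡ 3F) (uw : d u w ≡ 3F) (vw : d v w ≡ 3F) where

      -- Totals of these are [331] + [313] + [133], then [333], then [332] + [323] + [233], and
      -- finally 3 for the vertices u, v, w themselves.
      types : Fin 4 → TripleWeight
      types 0F i j k = ⟨ 3F , 3F , 1F ⟩ i j k + (⟨ 3F , 1F , 3F ⟩ i j k + ⟨ 1F , 3F , 3F ⟩ i j k)
      types 1F i j k = ⟨ 3F , 3F , 3F ⟩ i j k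
      types 2F i j k = ⟨ 3F , 3F , 2F ⟩ i j k + (⟨ 3F , 2F , 3F ⟩ i j k + ⟨ 2F , 3F , 3F ⟩ i j k)
      types 3F i j k = δ 0F i + (δ 0F j + δ 0F k)

      -- The three Krein sums add up to 3 `cubic` + 2q `quartic`, since `ε` is `e` plus 2q times its
      -- square. `pairs` counts the pairs among u, v, w both of whose members are at distance 3 from
      -- x.
      cubic quartic pairs : TripleWeight
      cubic i j k = e k * (e i * e j)
      quartic i j k = (e k * e k) * (e i * e j) + ((e i * e i) * (e j * e k) + (e j * e j) * (e i * e k))
      pairs i j k = δ 3F i * δ 3F j + (δ 3F i * δ 3F k + δ 3F j * δ 3F k)

      Apart : Fin 4 → Fin 4 → Fin 4 → Set
      Apart i j k = 3 ℕ.≤ toℕ i ℕ.+ toℕ j × 3 ℕ.≤ toℕ i ℕ.+ toℕ k × 3 ℕ.≤ toℕ j ℕ.+ toℕ k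

      apart? : ∀ i j k → Dec (Apart i j k)
      apart? i j k = 3 ℕ.≤? toℕ i ℕ.+ toℕ j ×-dec 3 ℕ.≤? toℕ i ℕ.+ toℕ k ×-dec 3 ℕ.≤? toℕ j ℕ.+ toℕ k

      cubic-coef quartic-coef pairs-coef : Fin 4 → ℤ
      cubic-coef 0F = + 1
      cubic-coef 1F = - (+ 1)
      cubic-coef 2F = + 0
      cubic-coef 3F = + 0

      quartic-coef 0F = - (+ 1)
      quartic-coef 1F = + 3
      quartic-coef 2F = + 0
      quartic-coef 3F = + 0

      pairs-coef 0F = + 1
      pairs-coef 1F = + 3
      pairs-coef 2F = + 1
      pairs-coef 3F = + 1

      -- A finite check over triples of distances. `cubic` and `quartic` need all three distances in
      -- {1, 3}, and `Apart` then forbids two 1s; `pairs` needs at least two 3s.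
      expansions : ∀ i j k → Apart i j k →
        cubic i j k ≡ ∑[ s < 4 ] (cubic-coef s * types s i j k) ×
        quartic i j k ≡ ∑[ s < 4 ] (quartic-coef s * types s i j k) ×
        pairs i j k ≡ ∑[ s < 4 ] (pairs-coef s * types s i j k)
      expansions = from-yes (Fin.all? λ i → Fin.all? λ j → Fin.all? λ k → apart? i j k →-dec
        (cubic i j k ℤ.≟ ∑[ s < 4 ] (cubic-coef s * types s i j k) ×-dec
         quartic i j k ℤ.≟ ∑[ s < 4 ] (quartic-coef s * types s i j k) ×-dec
         pairs i j k ℤ.≟ ∑[ s < 4 ] (pairs-coef s * types s i j k)))

      at-vertex : TripleWeight → Fin n → ℤ
      at-vertex Q x = Q (d u x) (d v x) (d w x)

      apart-at : ∀ x → Apart (d u x) (d v x) (d w x)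
      apart-at x = three-apart uv x , three-apart uw x , three-apart vw x

      total : Fin 4 → ℤ
      total s = ∑[ x < n ] at-vertex (types s) x

      total₃ : total 3F ≡ + 3
      total₃ = begin
        total 3F
          ≡⟨ trans (∑-+ (λ x → δ 0F (d u x)) λ x → δ 0F (d v x) + δ 0F (d w x))
               (cong (λ z → ∑[ x < n ] δ 0F (d u x) + z) (∑-+ (λ x → δ 0F (d v x)) λ x → δ 0F (d w x))) ⟩
        ∑[ x < n ] δ 0F (d u x) + (∑[ x < n ] δ 0F (d v x) + ∑[ x < n ] δ 0F (d w x))
          ≡⟨ cong₂ _+_ (one u) (cong₂ _+_ (one v) (one w)) ⟩
        + 3 ∎
        where
        one : ∀ y → ∑[ x < n ] δ 0F (d y x) ≡ 1ℤ
        one y = trans (∑-cong λ x → ≡-sym (ℤ.*-identityˡ (δ 0F (d y x)))) (∑-at (λ _ → 1ℤ) y)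

      pairs-sum : ∑[ x < n ] at-vertex pairs x ≡ p + (p + p)
      pairs-sum = begin
        ∑[ x < n ] at-vertex pairs x
          ≡⟨ trans (∑-+ (λ x → δ 3F (d u x) * δ 3F (d v x)) λ x → δ 3F (d u x) * δ 3F (d w x) + δ 3F (d v x) * δ 3F (d w x))
               (cong (λ z → ∑[ x < n ] (δ 3F (d u x) * δ 3F (d v x)) + z)
                 (∑-+ (λ x → δ 3F (d u x) * δ 3F (d w x)) λ x → δ 3F (d v x) * δ 3F (d w x))) ⟩
        ∑[ x < n ] (δ 3F (d u x) * δ 3F (d v x)) + (∑[ x < n ] (δ 3F (d u x) * δ 3F (d w x)) + ∑[ x < n ] (δ 3F (d v x) * δ 3F (d w x)))
          ≡⟨ cong₂ _+_ (pair uv) (cong₂ _+_ (pair uw) (pair vw)) ⟩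
        p + (p + p) ∎
        where
        pair : ∀ {y z} → d y z ≡ 3F → ∑[ x < n ] (δ 3F (d y x) * δ 3F (d z x)) ≡ p
        pair {y} {z} yz = trans (regular 3F 3F y z) (trans (cong (λ h → P h 3F 3F) yz) P333)

      -- The Krein equations with u, v and w in turn as the vertex carrying `ε`, added up; by
      -- symmetry all three have the right-hand side `R 3F 3F 3F`.
      krein-sum : + 3 * ∑[ x < n ] at-vertex cubic x + + 2 * q * ∑[ x < n ] at-vertex quartic x ≡
        + 3 * ((+ 4 * r + + 1) * (+ 4 * r - + 1))
      krein-sum = begin
        + 3 * ∑[ x < n ] at-vertex cubic x + + 2 * q * ∑[ x < n ] at-vertex quartic x
          ≡⟨ cong₂ _+_ (≡-sym (∑-* (+ 3) (at-vertex cubic))) (≡-sym (∑-* (+ 2 * q) (at-vertex quartic))) ⟩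
        ∑[ x < n ] (+ 3 * at-vertex cubic x) + ∑[ x < n ] (+ 2 * q * at-vertex quartic x)
          ≡⟨ ≡-sym (∑-+ (λ x → + 3 * at-vertex cubic x) (λ x → + 2 * q * at-vertex quartic x)) ⟩
        ∑[ x < n ] (+ 3 * at-vertex cubic x + + 2 * q * at-vertex quartic x)
          ≡⟨ ∑-cong (λ x → identity q (e (d u x)) (e (d v x)) (e (d w x))) ⟩
        ∑[ x < n ] (W x + (U x + V x))
          ≡⟨ trans (∑-+ W λ x → U x + V x) (cong (λ z → ∑[ x < n ] W x + z) (∑-+ U V)) ⟩
        ∑[ x < n ] W x + (∑[ x < n ] U x + ∑[ x < n ] V x)
          ≡⟨ cong₂ _+_ (krein° ∑ff ∑sqg uv uw vw)
               (cong₂ _+_ (krein° ∑ff ∑sqg vw (trans (d-sym v u) uv) (trans (d-sym w u) uw))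
                          (krein° ∑ff ∑sqg uw uv (trans (d-sym w v) vw))) ⟩
        R 3F 3F 3F + (R 3F 3F 3F + R 3F 3F 3F)
          ≡⟨ trans (triple (R 3F 3F 3F)) (cong (+ 3 *_) (R₃₃₃ r t)) ⟩
        + 3 * ((+ 4 * r + + 1) * (+ 4 * r - + 1)) ∎
        where
        triple : ∀ i → i + (i + i) ≡ + 3 * i
        triple = solve-∀

        R₃₃₃ : ∀ r t → let
            p = + 4 * r
            q = + 2 * r + + 1
            φ₃ = - (+ 1) + + 2 * q * + 1
            κ = (p + + 1) + + 2 * q * ((p + + 1) * (p + + 1)) in
          + 8 * q * ((r + t) * - (+ 1) + (t + + 2 * r * q) * + 1) - (p + + 1) * (φ₃ * - (+ 1)) - (p + + 1) * (- (+ 1) * φ₃) - κ * + 1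
          ≡ (+ 4 * r + + 1) * (+ 4 * r - + 1)
        R₃₃₃ = solve-∀

        U V W : Fin n → ℤ
        U x = ε (d u x) * (e (d v x) * e (d w x))
        V x = ε (d v x) * (e (d u x) * e (d w x))
        W x = ε (d w x) * (e (d u x) * e (d v x))

        identity : ∀ q x y z →
          + 3 * (z * (x * y)) + + 2 * q * ((z * z) * (x * y) + ((x * x) * (y * z) + (y * y) * (x * z))) ≡
          (z + + 2 * q * (z * z)) * (x * y) + ((x + + 2 * q * (x * x)) * (y * z) + (y + + 2 * q * (y * y)) * (x * z))
        identity = solve-∀

      cubic-total : ∑[ x < n ] at-vertex cubic x ≡ ∑[ s < 4 ] (cubic-coef s * total s)
      cubic-total = ∑-linear cubic-coef (λ s → at-vertex (types s)) (at-vertex cubic)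
        λ x → proj₁ (expansions (d u x) (d v x) (d w x) (apart-at x))

      quartic-total : ∑[ x < n ] at-vertex quartic x ≡ ∑[ s < 4 ] (quartic-coef s * total s)
      quartic-total = ∑-linear quartic-coef (λ s → at-vertex (types s)) (at-vertex quartic)
        λ x → proj₁ (proj₂ (expansions (d u x) (d v x) (d w x) (apart-at x)))

      pairs-total : ∑[ x < n ] at-vertex pairs x ≡ ∑[ s < 4 ] (pairs-coef s * total s)
      pairs-total = ∑-linear pairs-coef (λ s → at-vertex (types s)) (at-vertex pairs)
        λ x → proj₂ (proj₂ (expansions (d u x) (d v x) (d w x) (apart-at x)))

      -- Subtract the Krein sum from 4r + 1 times the pair count. In both, [333] has coefficient
      -- 3(4r + 1) and, once u, v, w are discounted, the constant is 3(4r + 1)(4r - 1), so both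
      -- cancel.
      balance : + 8 * r * total 0F + (+ 4 * r + + 1) * total 2F ≡ 0ℤ
      balance = combine (trans (≡-sym pairs-sum) pairs-total) total₃
        (trans (≡-sym (cong₂ (λ y z → + 3 * y + + 2 * q * z) cubic-total quartic-total)) krein-sum)
        where
        identity : ∀ r z n s y →
          + 8 * r * z + (+ 4 * r + + 1) * s ≡
          + 3 * ((+ 4 * r + + 1) * (+ 4 * r - + 1))
          - (+ 3 * (+ 1 * z + (- (+ 1) * n + (+ 0 * s + (+ 0 * y + + 0)))) + + 2 * (+ 2 * r + + 1) * (- (+ 1) * z + (+ 3 * n + (+ 0 * s + (+ 0 * y + + 0)))))
          + - (+ 4 * r + + 1) * ((+ 4 * r + (+ 4 * r + + 4 * r) - (+ 1 * z + (+ 3 * n + (+ 1 * s + (+ 1 * y + + 0))))) + (y - + 3))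
        identity = solve-∀

        combine : p + (p + p) ≡ ∑[ s < 4 ] (pairs-coef s * total s) → total 3F ≡ + 3 →
          + 3 * ∑[ s < 4 ] (cubic-coef s * total s) + + 2 * q * ∑[ s < 4 ] (quartic-coef s * total s) ≡
            + 3 * ((+ 4 * r + + 1) * (+ 4 * r - + 1)) →
          + 8 * r * total 0F + (+ 4 * r + + 1) * total 2F ≡ 0ℤ
        combine E₁ E₃ E₂ = trans (identity r (total 0F) (total 1F) (total 2F) (total 3F))
          (cong₂ _+_ (ℤ.i≡j⇒i-j≡0 (≡-sym E₂))
            (trans (cong (- (+ 4 * r + + 1) *_) (cong₂ _+_ (ℤ.i≡j⇒i-j≡0 E₁) (ℤ.i≡j⇒i-j≡0 E₃))) (ℤ.*-zeroʳ (- (+ 4 * r + + 1)))))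

      types-nonneg : ∀ s x → 0ℤ ≤ at-vertex (types s) x
      types-nonneg 0F x = ℤ.+-mono-≤ (indicator-nonneg 3F 3F 1F (d u x) (d v x) (d w x))
        (ℤ.+-mono-≤ (indicator-nonneg 3F 1F 3F (d u x) (d v x) (d w x)) (indicator-nonneg 1F 3F 3F (d u x) (d v x) (d w x)))
      types-nonneg 1F x = indicator-nonneg 3F 3F 3F (d u x) (d v x) (d w x)
      types-nonneg 2F x = ℤ.+-mono-≤ (indicator-nonneg 3F 3F 2F (d u x) (d v x) (d w x))
        (ℤ.+-mono-≤ (indicator-nonneg 3F 2F 3F (d u x) (d v x) (d w x)) (indicator-nonneg 2F 3F 3F (d u x) (d v x) (d w x)))
      types-nonneg 3F x = ℤ.+-mono-≤ (δ-nonneg 0F (d u x)) (ℤ.+-mono-≤ (δ-nonneg 0F (d v x)) (δ-nonneg 0F (d w x)))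

      total-nonneg : ∀ s → 0ℤ ≤ total s
      total-nonneg s = ∑-nonneg (at-vertex (types s)) (types-nonneg s)

      0<8r : 0ℤ < + 8 * r
      0<8r = 0<* {+ 8} {r} (ℤ.+<+ (ℕ.s≤s ℕ.z≤n)) 0<r

      totals-vanish : + 8 * r * total 0F ≡ 0ℤ × (+ 4 * r + + 1) * total 2F ≡ 0ℤ
      totals-vanish = nonneg-+-zero (nonneg-product (ℤ.<⇒≤ 0<8r) (total-nonneg 0F))
        (nonneg-product (ℤ.<⇒≤ (0<+1 0<p)) (total-nonneg 2F)) balance

      absent : ∀ s {m} → 0ℤ < m → m * total s ≡ 0ℤ → ∀ x → at-vertex (types s) x ≡ 0ℤ
      absent s {m} 0<m m*≡0 = ∑-nonneg-zero (at-vertex (types s)) (types-nonneg s)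
        (cancelˡ 0<m (trans m*≡0 (≡-sym (ℤ.*-zeroʳ m))))

      -- At distance 1 or 2 from w, the vertex x would contribute to one of the two totals in
      -- `balance`, which vanish because all terms there are nonnegative.
      clique : ∀ {x} → d u x ≡ 3F → d v x ≡ 3F → x ≢ w → d w x ≡ 3F
      clique {x} ux vx x≢w = go (d w x) refl
        where
        go : ∀ k → d w x ≡ k → d w x ≡ 3F
        go 0F wx = ⊥-elim (x≢w (≡-sym (d-zero wx)))
        go 1F wx = contradiction (at (types 0F) ux vx wx (absent 0F 0<8r (proj₁ totals-vanish) x)) λ ()
        go 2F wx = contradiction (at (types 2F) ux vx wx (absent 2F (0<+1 0<p) (proj₂ totals-vanish) x)) λ ()
        go 3F wx = wx

    open Clique using (clique)

    -- The configuration u, v, w, y and the parity contradiction.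

    module Configuration {u v w y : Fin n}
      (uv : d u v ≡ 2F) (uw : d u w ≡ 3F) (vw : d v w ≡ 3F)
      (uy : d u y ≡ 3F) (vy : d v y ≡ 1F) (wy : d w y ≡ 3F) where

      types : Fin 4 → TripleWeight
      types 0F = ⟨ 1F , 1F , 3F ⟩
      types 1F = ⟨ 1F , 3F , 3F ⟩
      types 2F = ⟨ 3F , 1F , 3F ⟩
      types 3F = ⟨ 3F , 3F , 1F ⟩

      cubic quarticᵘ quarticᵛ quarticʷ : TripleWeight
      cubic i j k = e i * (e j * e k)
      quarticᵘ i j k = (e i * e i) * (e j * e k)
      quarticᵛ i j k = (e j * e j) * (e i * e k)
      quarticʷ i j k = (e k * e k) * (e i * e j)

      coef : ℤ → ℤ → ℤ → ℤ → Fin 4 → ℤ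
      coef c₀ c₁ c₂ c₃ 0F = c₀
      coef c₀ c₁ c₂ c₃ 1F = c₁
      coef c₀ c₁ c₂ c₃ 2F = c₂
      coef c₀ c₁ c₂ c₃ 3F = c₃

      -- The values of the four products at the types 113, 133, 313, 331, where `e` is 1 at distance
      -- 1 and -1 at distance 3.
      cubic-coef coefᵘ coefᵛ coefʷ : Fin 4 → ℤ
      cubic-coef = coef (- (+ 1)) (+ 1) (+ 1) (+ 1)
      coefᵘ = coef (- (+ 1)) (+ 1) (- (+ 1)) (- (+ 1))
      coefᵛ = coef (- (+ 1)) (- (+ 1)) (+ 1) (- (+ 1))
      coefʷ = coef (+ 1) (- (+ 1)) (- (+ 1)) (+ 1)

      -- The products vanish unless all distances are 1 or 3. Of those triples the triangle
      -- inequalities through w leave only the four types and 333, which `no-apex` rules out.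
      Expansion : TripleWeight → (Fin 4 → ℤ) → Set
      Expansion Q coef = ∀ i j k → 3 ℕ.≤ toℕ i ℕ.+ toℕ k → 3 ℕ.≤ toℕ j ℕ.+ toℕ k →
        ¬ (i ≡ 3F × j ≡ 3F × k ≡ 3F) → Q i j k ≡ ∑[ s < 4 ] (coef s * types s i j k)

      expansion? : ∀ Q coef → Dec (Expansion Q coef)
      expansion? Q coef = Fin.all? λ i → Fin.all? λ j → Fin.all? λ k →
        3 ℕ.≤? toℕ i ℕ.+ toℕ k →-dec 3 ℕ.≤? toℕ j ℕ.+ toℕ k →-dec
        ¬? (i Fin.≟ 3F ×-dec j Fin.≟ 3F ×-dec k Fin.≟ 3F) →-dec
        Q i j k ℤ.≟ ∑[ s < 4 ] (coef s * types s i j k)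

      at-vertex : TripleWeight → Fin n → ℤ
      at-vertex Q x = Q (d u x) (d v x) (d w x)

      total : Fin 4 → ℤ
      total s = ∑[ x < n ] at-vertex (types s) x

      -- Otherwise u and v would both be at distance 3 from the two vertices w and x, themselves at
      -- distance 3, and `clique` would give d(u,v) = 3.
      no-apex : ∀ x → ¬ (d u x ≡ 3F × d v x ≡ 3F × d w x ≡ 3F)
      no-apex x (ux , vx , wx) = contradiction (trans (≡-sym uv)
        (clique wx (trans (d-sym w u) uw) (trans (d-sym x u) ux) (trans (d-sym w v) vw) (trans (d-sym x v) vx)
          λ { refl → contradiction (trans (≡-sym (d-refl u)) uv) λ () })) λ ()

      total-at : ∀ Q coef → Expansion Q coef → ∑[ x < n ] at-vertex Q x ≡ ∑[ s < 4 ] (coef s * total s)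
      total-at Q coef expansion = ∑-linear coef (λ s → at-vertex (types s)) (at-vertex Q) λ x →
        expansion (d u x) (d v x) (d w x) (three-apart uw x) (three-apart vw x) (no-apex x)

      -- y is counted. By `clique` any other such x has distance 3 from y, although v is adjacent to
      -- both.
      total₂ : total 2F ≡ + 1
      total₂ = trans (∑-single (at-vertex (types 2F)) y unique) (types-y uy vy wy)
        where
        types-y : ∀ {i j k} → i ≡ 3F → j ≡ 1F → k ≡ 3F → types 2F i j k ≡ + 1
        types-y refl refl refl = refl

        too-far : ∀ {x} → x ≢ y → d u x ≡ 3F → d v x ≡ 1F → d w x ≡ 3F → ⊥
        too-far {x} x≢y ux vx wx = ℕ.<-irrefl refl
          (subst₂ (λ i j → 3 ℕ.≤ toℕ i ℕ.+ toℕ j) (trans (d-sym y v) vy) (trans (d-sym x v) vx)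
            (three-apart (clique uw uy wy ux wx x≢y) v))

        vanishing : ∀ i j k → ¬ (i ≡ 3F × j ≡ 1F × k ≡ 3F) → types 2F i j k ≡ 0ℤ
        vanishing = from-yes (Fin.all? λ i → Fin.all? λ j → Fin.all? λ k →
          ¬? (i Fin.≟ 3F ×-dec j Fin.≟ 1F ×-dec k Fin.≟ 3F) →-dec types 2F i j k ℤ.≟ 0ℤ)

        unique : ∀ x → x ≢ y → at-vertex (types 2F) x ≡ 0ℤ
        unique x x≢y with d u x Fin.≟ 3F ×-dec d v x Fin.≟ 1F ×-dec d w x Fin.≟ 3F
        ... | yes (ux , vx , wx) = ⊥-elim (too-far x≢y ux vx wx)
        ... | no  other = vanishing (d u x) (d v x) (d w x) other

      cubic-sum : ∑[ x < n ] at-vertex cubic x ≡ ∑[ s < 4 ] (cubic-coef s * total s)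
      cubic-sum = total-at cubic cubic-coef (from-yes (expansion? cubic cubic-coef))

      krein-at : ∀ {Q coef h} (F : Fin n → ℤ) → Expansion Q coef →
        (∀ x → F x ≡ at-vertex cubic x + + 2 * q * at-vertex Q x) → ∑[ x < n ] F x ≡ h →
        ∑[ s < 4 ] (cubic-coef s * total s) + + 2 * q * ∑[ s < 4 ] (coef s * total s) ≡ h
      krein-at {Q} {coef} {h} F expansion F≗ ∑F = begin
        ∑[ s < 4 ] (cubic-coef s * total s) + + 2 * q * ∑[ s < 4 ] (coef s * total s)
          ≡⟨ cong₂ (λ a b → a + + 2 * q * b) (≡-sym cubic-sum) (≡-sym (total-at Q coef expansion)) ⟩
        ∑[ x < n ] at-vertex cubic x + + 2 * q * ∑[ x < n ] at-vertex Q x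
          ≡⟨ cong (λ z → ∑[ x < n ] at-vertex cubic x + z) (≡-sym (∑-* (+ 2 * q) (at-vertex Q))) ⟩
        ∑[ x < n ] at-vertex cubic x + ∑[ x < n ] (+ 2 * q * at-vertex Q x)
          ≡⟨ ≡-sym (∑-+ (at-vertex cubic) (λ x → + 2 * q * at-vertex Q x)) ⟩
        ∑[ x < n ] (at-vertex cubic x + + 2 * q * at-vertex Q x)
          ≡⟨ ∑-cong (λ x → ≡-sym (F≗ x)) ⟩
        ∑[ x < n ] F x
          ≡⟨ ∑F ⟩
        h ∎

      kreinᵘ : ∑[ s < 4 ] (cubic-coef s * total s) + + 2 * q * ∑[ s < 4 ] (coefᵘ s * total s) ≡ R 3F 2F 3F
      kreinᵘ = krein-at {quarticᵘ} {coefᵘ} (λ x → ε (d u x) * (e (d v x) * e (d w x))) (from-yes (expansion? quarticᵘ coefᵘ))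
        (λ x → identity q (e (d u x)) (e (d v x)) (e (d w x)))
        (krein° ∑ff ∑sqg vw (trans (d-sym v u) uv) (trans (d-sym w u) uw))
        where
        identity : ∀ q x y z → (x + + 2 * q * (x * x)) * (y * z) ≡ x * (y * z) + + 2 * q * ((x * x) * (y * z))
        identity = solve-∀

      kreinᵛ : ∑[ s < 4 ] (cubic-coef s * total s) + + 2 * q * ∑[ s < 4 ] (coefᵛ s * total s) ≡ R 3F 2F 3F
      kreinᵛ = krein-at {quarticᵛ} {coefᵛ} (λ x → ε (d v x) * (e (d u x) * e (d w x))) (from-yes (expansion? quarticᵛ coefᵛ))
        (λ x → identity q (e (d u x)) (e (d v x)) (e (d w x)))
        (krein° ∑ff ∑sqg uw uv (trans (d-sym w v) vw))
        where
        identity : ∀ q x y z → (y + + 2 * q * (y * y)) * (x * z) ≡ x * (y * z) + + 2 * q * ((y * y) * (x * z))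
        identity = solve-∀

      kreinʷ : ∑[ s < 4 ] (cubic-coef s * total s) + + 2 * q * ∑[ s < 4 ] (coefʷ s * total s) ≡ R 2F 3F 3F
      kreinʷ = krein-at {quarticʷ} {coefʷ} (λ x → ε (d w x) * (e (d u x) * e (d v x))) (from-yes (expansion? quarticʷ coefʷ))
        (λ x → identity q (e (d u x)) (e (d v x)) (e (d w x)))
        (krein° ∑ff ∑sqg uv uw vw)
        where
        identity : ∀ q x y z → (z + + 2 * q * (z * z)) * (x * y) ≡ x * (y * z) + + 2 * q * ((z * z) * (x * y))
        identity = solve-∀

      0<4q : 0ℤ < + 4 * q
      0<4q = 0<* {+ 4} {q} (ℤ.+<+ (ℕ.s≤s ℕ.z≤n)) (0<+1 (0<* {+ 2} {r} (ℤ.+<+ (ℕ.s≤s ℕ.z≤n)) 0<r))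

      -- The equations `kreinᵘ` and `kreinᵛ` have the same right-hand side; their difference is
      -- 4q([133] - [313]) = 0.
      total₁ : total 1F ≡ total 2F
      total₁ = cancelˡ 0<4q (trans (identity q (total 0F) (total 1F) (total 2F) (total 3F))
        (trans (cong (λ z → + 4 * q * total 2F + z) (ℤ.i≡j⇒i-j≡0 (trans kreinᵘ (≡-sym kreinᵛ)))) (ℤ.+-identityʳ _)))
        where
        identity : ∀ q a b c d → let
            X = - (+ 1) * a + (+ 1 * b + (+ 1 * c + (+ 1 * d + + 0)))
            U = - (+ 1) * a + (+ 1 * b + (- (+ 1) * c + (- (+ 1) * d + + 0)))
            V = - (+ 1) * a + (- (+ 1) * b + (+ 1 * c + (- (+ 1) * d + + 0))) in
          + 4 * q * b ≡ + 4 * q * c + ((X + + 2 * q * U) - (X + + 2 * q * V))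
        identity = solve-∀

      -- The difference of `kreinʷ` and `kreinᵘ`, divided by 4q.
      total₀₃ : total 0F + total 3F - total 1F ≡ + 4 * t - + 1
      total₀₃ = cancelˡ 0<4q (begin
        + 4 * q * (total 0F + total 3F - total 1F)
          ≡⟨ identity q (total 0F) (total 1F) (total 2F) (total 3F) ⟩
        ∑[ s < 4 ] (cubic-coef s * total s) + + 2 * q * ∑[ s < 4 ] (coefʷ s * total s)
          - (∑[ s < 4 ] (cubic-coef s * total s) + + 2 * q * ∑[ s < 4 ] (coefᵘ s * total s))
          ≡⟨ cong₂ _-_ kreinʷ kreinᵘ ⟩
        R 2F 3F 3F - R 3F 2F 3F
          ≡⟨ difference r t ⟩
        + 4 * q * (+ 4 * t - + 1) ∎)
        where
        identity : ∀ q a b c d → let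
            X = - (+ 1) * a + (+ 1 * b + (+ 1 * c + (+ 1 * d + + 0)))
            U = - (+ 1) * a + (+ 1 * b + (- (+ 1) * c + (- (+ 1) * d + + 0)))
            W = + 1 * a + (- (+ 1) * b + (- (+ 1) * c + (+ 1 * d + + 0))) in
          + 4 * q * (a + d - b) ≡ (X + + 2 * q * W) - (X + + 2 * q * U)
        identity = solve-∀

        difference : ∀ r t → let
            p = + 4 * r
            q = + 2 * r + + 1
            φ₂ = + 0 + + 2 * q * + 0
            φ₃ = - (+ 1) + + 2 * q * + 1
            κ = (p + + 1) + + 2 * q * ((p + + 1) * (p + + 1)) in
          (+ 8 * q * ((r + t) * + 0 + (t + + 2 * r * q) * + 1) - (p + + 1) * (φ₃ * + 0) - (p + + 1) * (+ 0 * φ₃) - κ * + 1)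
          - (+ 8 * q * ((r + t) * - (+ 1) + (t + + 2 * r * q) * + 0) - (p + + 1) * (φ₂ * - (+ 1)) - (p + + 1) * (- (+ 1) * φ₃) - κ * + 0)
          ≡ + 4 * q * (+ 4 * t - + 1)
        difference = solve-∀

      -- With [133] = [313] = 1, `total₀₃` gives [113] + [331] = 4t and `kreinᵘ` then gives [113] -
      -- [331] = 1; adding these yields 2[113] = 4t + 1.
      half-integral : + 2 * (total 0F - + 2 * t) ≡ + 1
      half-integral = conclude (total 0F) (total 1F) (total 2F) (total 3F) (trans total₁ total₂) total₂ total₀₃ kreinᵘ
        where
        identity : ∀ r t a d → let
            p = + 4 * r
            q = + 2 * r + + 1
            φ₂ = + 0 + + 2 * q * + 0
            φ₃ = - (+ 1) + + 2 * q * + 1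
            κ = (p + + 1) + + 2 * q * ((p + + 1) * (p + + 1))
            X = - (+ 1) * a + (+ 1 * + 1 + (+ 1 * + 1 + (+ 1 * d + + 0)))
            U = - (+ 1) * a + (+ 1 * + 1 + (- (+ 1) * + 1 + (- (+ 1) * d + + 0)))
            -- `A` and `B` are the differences of the two sides of `total₀₃` and `kreinᵘ`, with the
            -- known counts set to 1.
            A = (a + d - + 1) - (+ 4 * t - + 1)
            B = (X + + 2 * q * U) -
              (+ 8 * q * ((r + t) * - (+ 1) + (t + + 2 * r * q) * + 0) - (p + + 1) * (φ₂ * - (+ 1)) - (p + + 1) * (- (+ 1) * φ₃) - κ * + 0) in
          + 2 * (a - + 2 * t) ≡ + 1 + (A - (B + + 2 * q * A))
        identity = solve-∀

        conclude : ∀ a b c d → b ≡ + 1 → c ≡ + 1 → a + d - b ≡ + 4 * t - + 1 →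
          - (+ 1) * a + (+ 1 * b + (+ 1 * c + (+ 1 * d + + 0)))
            + + 2 * q * (- (+ 1) * a + (+ 1 * b + (- (+ 1) * c + (- (+ 1) * d + + 0)))) ≡ R 3F 2F 3F →
          + 2 * (a - + 2 * t) ≡ + 1
        conclude a _ _ d refl refl A≡0 B≡0 = trans (identity r t a d)
          (trans (cong₂ (λ A B → + 1 + (A - (B + + 2 * q * A))) (ℤ.i≡j⇒i-j≡0 A≡0) (ℤ.i≡j⇒i-j≡0 B≡0))
            (cong (λ z → + 1 + (+ 0 - (+ 0 + z))) (ℤ.*-zeroʳ (+ 2 * q))))

      impossible : ⊥
      -- Absolute values turn the equation into one between an even natural number and 1 = 2 · 0 +
      -- 1.
      impossible = ℕ.even≢odd ℤ.∣ total 0F - + 2 * t ∣ 0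
        (trans (≡-sym (ℤ.abs-* (+ 2) (total 0F - + 2 * t))) (cong ℤ.∣_∣ half-integral))

    -- Existence of the configuration.

    0<⇒≢0 : ∀ {i} → 0ℤ < i → i ≢ 0ℤ
    0<⇒≢0 0<i refl = ℤ.<-irrefl refl 0<i

    meet : ∀ i j {h m u v} → d u v ≡ h → P h i j ≡ m → 0ℤ < m → ∃[ x ] (d u x ≡ i × d v x ≡ j)
    meet i j {u = u} {v} refl refl 0<P = P-present i j u v (0<⇒≢0 0<P)

    -- Distance 0 contradicts d(u₀,y) = 3, distance 1 gives a path of length 2 from u₀ to y through
    -- v, and distance 3 would by `clique` put v at distance 3 from its neighbour y.
    two-apart : ∀ {y v} → d u₀ y ≡ 3F → d v₀ y ≡ 3F → d y v ≡ 1F → d v₀ v ≡ 3F → d u₀ v ≡ 2F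
    two-apart {y} {v} uy wy yv wv = go (d u₀ v) refl
      where
      go : ∀ h → d u₀ v ≡ h → d u₀ v ≡ 2F
      go 0F uv = contradiction (trans (≡-sym yv) (trans (cong (d y) (≡-sym (d-zero uv))) (trans (d-sym y u₀) uy))) λ ()
      go 1F uv = ⊥-elim (ℕ.<-irrefl refl (subst₂ (λ i j → 3 ℕ.≤ toℕ i ℕ.+ toℕ j) uv yv (three-apart uy v)))
      go 2F uv = uv
      go 3F uv = contradiction
        (trans (≡-sym yv) (clique d₃ uy wy uv wv λ { refl → contradiction (trans (≡-sym (d-refl y)) yv) λ () }))
        λ ()

    -- The given pair u₀, v₀ serves as u, w. Then y exists because p³₃₃ = p > 0, and v because p³₁₃
    -- = a > 0.
    nonexistence : ⊥
    nonexistence = from-y (meet 3F 3F d₃ P333 0<p)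
      where
      from-v : ∀ {y} → d u₀ y ≡ 3F → d v₀ y ≡ 3F → ∃[ v ] (d y v ≡ 1F × d v₀ v ≡ 3F) → ⊥
      from-v {y} uy wy (v , yv , wv) = Configuration.impossible
        (two-apart uy wy yv wv) d₃ (trans (d-sym v v₀) wv) uy (trans (d-sym v y) yv) wy

      from-y : ∃[ y ] (d u₀ y ≡ 3F × d v₀ y ≡ 3F) → ⊥
      from-y (y , uy , wy) = from-v uy wy (meet 1F 3F (trans (d-sym y v₀) wy) P313 0<a)

-- Walks and distances in a graph.

module Distance {n : ℕ} (G : SimpleGraph n) where

  reach-suc : ∀ k {u v} → T (reach G k u v) → T (reach G (ℕ.suc k) u v)
  reach-suc k r = Equivalence.from T-∨ (inj₁ r)

  reach-edge : ∀ k {u x v} → T (reach G k u x) → T (adj G x v) → T (reach G (ℕ.suc k) u v)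
  reach-edge k {u} {x} {v} r e = Equivalence.from (T-∨ {reach G k u v})
    (inj₂ (any⁺ _ (lose (∈-allFin x) (Equivalence.from T-∧ (r , e)))))

  reach-split : ∀ k {u v} → T (reach G (ℕ.suc k) u v) →
    T (reach G k u v) ⊎ ∃[ x ] (T (reach G k u x) × T (adj G x v))
  reach-split k {u} {v} r with Equivalence.to (T-∨ {reach G k u v}) r
  ... | inj₁ s = inj₁ s
  ... | inj₂ s with satisfied (any⁻ _ (allFin n) s)
  ... | x , q = inj₂ (x , Equivalence.to T-∧ q)

  reach-mono : ∀ {i j u v} → i ℕ.≤′ j → T (reach G i u v) → T (reach G j u v)
  reach-mono (ℕ.≤′-reflexive refl)     r = r
  reach-mono (ℕ.≤′-step {j} i≤j) r = reach-suc j (reach-mono i≤j r)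

  reach-refl : ∀ u → T (reach G 0 u u)
  reach-refl u = fromWitness {a? = u Fin.≟ u} refl

  reach-trans : ∀ i j {u x v} → T (reach G i u x) → T (reach G j x v) → T (reach G (i ℕ.+ j) u v)
  reach-trans i ℕ.zero {u} {x} {v} r s
    rewrite ℕ.+-identityʳ i = subst (λ y → T (reach G i u y)) (toWitness {a? = x Fin.≟ v} s) r
  reach-trans i (ℕ.suc j) r s rewrite ℕ.+-suc i j with reach-split j s
  ... | inj₁ s′           = reach-suc (i ℕ.+ j) (reach-trans i j r s′)
  ... | inj₂ (y , s′ , e) = reach-edge (i ℕ.+ j) (reach-trans i j r s′) e

  -- `reach` extends walks at their end, so the last edge, reversed, becomes a walk of one step to
  -- which the reversed remainder is appended.
  reach-sym : ∀ k {u v} → T (reach G k u v) → T (reach G k v u)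
  reach-sym ℕ.zero {u} {v} r = fromWitness {a? = v Fin.≟ u} (≡-sym (toWitness {a? = u Fin.≟ v} r))
  reach-sym (ℕ.suc k) {u} {v} r with reach-split k r
  ... | inj₁ s           = reach-suc k (reach-sym k s)
  ... | inj₂ (x , s , e) =
    reach-trans 1 k (reach-edge 0 (reach-refl v) (subst T (sym G x v) e)) (reach-sym k s)

  distIs⇒reach : ∀ h {u v} → T (distIs G h u v) → T (reach G h u v)
  distIs⇒reach ℕ.zero    r = r
  distIs⇒reach (ℕ.suc h) r = proj₁ (Equivalence.to T-∧ r)

  -- If j were at most h, monotonicity would make v reachable in h steps, which the second conjunct
  -- of `distIs` at h + 1 denies.
  distIs-minimal : ∀ h {j u v} → T (distIs G h u v) → T (reach G j u v) → h ℕ.≤ j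
  distIs-minimal ℕ.zero _ _ = ℕ.z≤n
  distIs-minimal (ℕ.suc h) {j} {u} {v} r s with h ℕ.<? j
  ... | yes h<j = h<j
  ... | no  h≮j with reach G h u v | reach-mono {j = h} {u} {v} (ℕ.≤⇒≤′ (ℕ.≮⇒≥ h≮j)) s
  ... | true | _ = ⊥-elim r

  distIs-unique : ∀ {h j u v} → T (distIs G h u v) → T (distIs G j u v) → h ≡ j
  distIs-unique {h} {j} r s =
    ℕ.≤-antisym (distIs-minimal h r (distIs⇒reach j s)) (distIs-minimal j s (distIs⇒reach h r))

-- From a distance-regular graph to its distance scheme.

T-injective : ∀ {a b} → (T a → T b) → (T b → T a) → a ≡ b
T-injective {false} {false} f g = refl
T-injective {false} {true}  f g = ⊥-elim (g _)
T-injective {true}  {false} f g = ⊥-elim (f _)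
T-injective {true}  {true}  f g = refl

pos-if-∧ : ∀ a b → + (if a ∧ b then 1 else 0) ≡ (if a then 1ℤ else 0ℤ) ℤ.* (if b then 1ℤ else 0ℤ)
pos-if-∧ true  true  = refl
pos-if-∧ true  false = refl
pos-if-∧ false true  = refl
pos-if-∧ false false = refl

pos-sum-tabulate : ∀ {n} (h : Fin n → ℕ) → + List.sum (tabulate h) ≡ ∑[ x < n ] (+ h x)
pos-sum-tabulate {ℕ.zero}  h = refl
pos-sum-tabulate {ℕ.suc n} h =
  trans (ℤ.pos-+ (h 0F) _) (cong (λ s → ℤ._+_ (+ h 0F) s) (pos-sum-tabulate (h ∘ suc)))

module FromGraph {n : ℕ} (G : SimpleGraph n) (p : ℕ → ℕ → ℕ → ℕ)
                 (dr : IsDistanceRegular G 3 p) where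
  open Distance G

  private
    conn : ∀ u v → ∃[ h ] (h ℕ.≤ 3 × T (distIs G h u v))
    conn = proj₁ (proj₁ dr)

    dist : Fin n → Fin n → Fin 4
    dist u v = fromℕ< (ℕ.s≤s (proj₁ (proj₂ (conn u v))))

    toℕ-dist : ∀ u v → toℕ (dist u v) ≡ proj₁ (conn u v)
    toℕ-dist u v = Fin.toℕ-fromℕ< _

    dist-spec : ∀ u v → T (distIs G (toℕ (dist u v)) u v)
    dist-spec u v rewrite toℕ-dist u v = proj₂ (proj₂ (conn u v))

    dist-reach : ∀ u v → T (reach G (toℕ (dist u v)) u v)
    dist-reach u v = distIs⇒reach (toℕ (dist u v)) (dist-spec u v)

    dist-minimal : ∀ {u v} k → T (reach G k u v) → toℕ (dist u v) ℕ.≤ k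
    dist-minimal {u} {v} k = distIs-minimal (toℕ (dist u v)) (dist-spec u v)

    dist-unique : ∀ i {u v} → T (distIs G (toℕ i) u v) → i ≡ dist u v
    dist-unique i {u} {v} q = Fin.toℕ-injective (distIs-unique q (dist-spec u v))

    distIs-dist : ∀ i u v → distIs G (toℕ i) u v ≡ ⌊ i Fin.≟ dist u v ⌋
    distIs-dist i u v = T-injective
      (λ q → fromWitness (dist-unique i q))
      (λ q → subst (λ j → T (distIs G (toℕ j) u v)) (≡-sym (toWitness q)) (dist-spec u v))

    dist-sym-≤ : ∀ u v → toℕ (dist u v) ℕ.≤ toℕ (dist v u)
    dist-sym-≤ u v = dist-minimal _ (reach-sym (toℕ (dist v u)) (dist-reach v u))

    dist-sym : ∀ u v → dist u v ≡ dist v u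
    dist-sym u v = Fin.toℕ-injective (ℕ.≤-antisym (dist-sym-≤ u v) (dist-sym-≤ v u))

    -- Turns the Boolean count into an integer sum of products of deltas, term by term.
    count-∑ : ∀ i j u v → + count G (λ x → distIs G (toℕ i) u x ∧ distIs G (toℕ j) v x)
                        ≡ ∑[ x < n ] (δ i (dist u x) ℤ.* δ j (dist v x))
    count-∑ i j u v = trans
      (trans (cong (+_ ∘ List.sum) (map-tabulate {n = n} id _)) (pos-sum-tabulate {n} _))
      (sum-cong-≗ {n} λ x → trans (pos-if-∧ (distIs G (toℕ i) u x) _)
        (cong₂ (λ a b → (if a then 1ℤ else 0ℤ) ℤ.* (if b then 1ℤ else 0ℤ))
               (distIs-dist i u x) (distIs-dist j v x)))

  scheme : DistanceScheme n
  scheme = record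
    { d        = dist
    ; d-refl   = λ u → ≡-sym (dist-unique 0F (reach-refl u))
    ; d-zero   = λ {u} {v} e → toWitness (subst (λ i → T (reach G (toℕ i) u v)) e (dist-reach u v))
    ; d-sym    = dist-sym
    ; triangle = λ u x v → subst (λ i → toℕ (dist u v) ℕ.≤ toℕ (dist u x) ℕ.+ toℕ i) (dist-sym x v)
        (dist-minimal _ (reach-trans (toℕ (dist u x)) (toℕ (dist x v)) (dist-reach u x) (dist-reach x v)))
    ; P        = λ h i j → + p (toℕ h) (toℕ i) (toℕ j)
    ; regular  = λ i j u v → trans (≡-sym (count-∑ i j u v))
        (cong +_ (proj₂ dr _ _ _ (Fin.toℕ≤pred[n] (dist u v)) (Fin.toℕ≤pred[n] i) (Fin.toℕ≤pred[n] j) u v (dist-spec u v)))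
    }

  diameter-pair : ∃[ u ] ∃[ v ] DistanceScheme.d scheme u v ≡ 3F
  diameter-pair with proj₂ (proj₁ dr)
  ... | u , v , q = u , v , ≡-sym (dist-unique 3F q)

-- The array entries as integers, in terms of a and p.

module Cast where
  open import Data.Integer using (_+_; _*_; _-_)

  pos-∸ : ∀ {m k} → k ℕ.≤ m → + (m ℕ.∸ k) ≡ + m - + k
  pos-∸ {m} {k} k≤m = trans (≡-sym (ℤ.⊖-≥ k≤m)) (≡-sym (ℤ.m-n≡m⊖n m k))

  infixl 7 _⊗_
  infixl 6 _⊕_

  -- With `_⊕_` and `lit`, this lets a proof term copy the shape of a natural-number expression and
  -- so compute its cast.
  _⊗_ : ∀ {m k i j} → + m ≡ i → + k ≡ j → + (m ℕ.* k) ≡ i * j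
  _⊗_ {m} {k} refl refl = ℤ.pos-* m k

  _⊕_ : ∀ {m k i j} → + m ≡ i → + k ≡ j → + (m ℕ.+ k) ≡ i + j
  refl ⊕ refl = refl

  lit : ∀ m → + m ≡ + m
  lit m = refl

  module _ (r t : ℕ) (t≥1 : t ℕ.≥ 1) where
    cast-4t∸1 : + (4 ℕ.* t ℕ.∸ 1) ≡ + 4 * + t - + 1
    cast-4t∸1 = trans (pos-∸ (ℕ.≤-trans t≥1 (ℕ.m≤m+n t _))) (cong (_- + 1) (lit 4 ⊗ lit t))

    -- Since t ≥ 1, r is at most 4rt, so the subtraction is not truncated.
    cast-4rt∸r : + (4 ℕ.* r ℕ.* t ℕ.∸ r) ≡ + 4 * + r * + t - + r
    cast-4rt∸r = trans
      (pos-∸ (ℕ.≤-trans (ℕ.m≤m+n r _) (ℕ.m≤m*n (4 ℕ.* r) t {{ℕ.>-nonZero t≥1}})))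
      (cong (_- + r) (lit 4 ⊗ lit r ⊗ lit t))

    cast-b₀ : + ((2 ℕ.* r ℕ.+ 1) ℕ.* (4 ℕ.* r ℕ.+ 1) ℕ.* (4 ℕ.* t ℕ.∸ 1)) ≡
      (+ 2 * + r + + 1) * (+ 4 * + t - + 1) * (+ 4 * + r + + 1)
    cast-b₀ = trans ((lit 2 ⊗ lit r ⊕ lit 1) ⊗ (lit 4 ⊗ lit r ⊕ lit 1) ⊗ cast-4t∸1) (identity (+ r) (+ t))
      where
      identity : ∀ r t → (+ 2 * r + + 1) * (+ 4 * r + + 1) * (+ 4 * t - + 1) ≡ (+ 2 * r + + 1) * (+ 4 * t - + 1) * (+ 4 * r + + 1)
      identity = solve-∀

    cast-b₁ : + (8 ℕ.* r ℕ.* (4 ℕ.* r ℕ.* t ℕ.∸ r ℕ.+ 2 ℕ.* t)) ≡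
      ((+ 2 * + r + + 1) * (+ 4 * + t - + 1) + + 1) * (+ 4 * + r)
    cast-b₁ = trans (lit 8 ⊗ lit r ⊗ (cast-4rt∸r ⊕ lit 2 ⊗ lit t)) (identity (+ r) (+ t))
      where
      identity : ∀ r t → + 8 * r * (+ 4 * r * t - r + + 2 * t) ≡ ((+ 2 * r + + 1) * (+ 4 * t - + 1) + + 1) * (+ 4 * r)
      identity = solve-∀

    cast-c₂ : + ((r ℕ.+ t) ℕ.* (4 ℕ.* r ℕ.+ 1)) ≡ (+ r + + t) * (+ 4 * + r + + 1)
    cast-c₂ = (lit r ⊕ lit t) ⊗ (lit 4 ⊗ lit r ⊕ lit 1)

    cast-c₃ : + (4 ℕ.* r ℕ.* (2 ℕ.* r ℕ.+ 1) ℕ.* (4 ℕ.* t ℕ.∸ 1)) ≡ (+ 2 * + r + + 1) * (+ 4 * + t - + 1) * (+ 4 * + r)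
    cast-c₃ = trans (lit 4 ⊗ lit r ⊗ (lit 2 ⊗ lit r ⊕ lit 1) ⊗ cast-4t∸1) (identity (+ r) (+ t))
      where
      identity : ∀ r t → + 4 * r * (+ 2 * r + + 1) * (+ 4 * t - + 1) ≡ (+ 2 * r + + 1) * (+ 4 * t - + 1) * (+ 4 * r)
      identity = solve-∀

    a-positive : 0ℤ ℤ.< (+ 2 * + r + + 1) * (+ 4 * + t - + 1)
    a-positive = IntegerSums.0<*
      (subst (0ℤ ℤ.<_) (lit 2 ⊗ lit r ⊕ lit 1) (ℤ.+<+ (ℕ.m≤n+m 1 (2 ℕ.* r))))
      (subst (0ℤ ℤ.<_) cast-4t∸1 (ℤ.+<+ (ℕ.∸-monoˡ-≤ 1 (ℕ.≤-trans (ℕ.s≤s (ℕ.s≤s ℕ.z≤n)) (ℕ.*-monoʳ-≤ 4 t≥1)))))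

-- The theorem for graphs.

open import Data.Nat using (_+_; _*_; _∸_; _≥_)
open import Data.Vec using ([]; _∷_)

theorem3 : (r t : ℕ) → r ≥ 1 → t ≥ 1 → (n : ℕ) → (G : SimpleGraph n) →
    ¬ HasIntersectionArray G 3
    ((2 * r + 1) * (4 * r + 1) * (4 * t ∸ 1) ∷ 8 * r * (4 * r * t ∸ r + 2 * t) ∷ (r + t) * (4 * r + 1) ∷ [])
    (1 ∷ (r + t) * (4 * r + 1) ∷ 4 * r * (2 * r + 1) * (4 * t ∸ 1) ∷ [])
theorem3 r t r≥1 t≥1 n G (p , dr , array) =
  Nonexistence.nonexistence (FromGraph.scheme G p dr) (+ r) (+ t) (ℤ.+<+ r≥1) (ℤ.+<+ t≥1) (a-positive r t t≥1)
    (trans (cong +_ (proj₁ (array 0F))) (cast-b₀ r t t≥1))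
    (trans (cong +_ (proj₁ (array 1F))) (cast-b₁ r t t≥1))
    (trans (cong +_ (proj₁ (array 2F))) (cast-c₂ r t t≥1))
    -- The second list starts at c₁, so index 1 holds c₂ and index 2 holds c₃.
    (trans (cong +_ (proj₂ (array 1F))) (cast-c₂ r t t≥1))
    (trans (cong +_ (proj₂ (array 2F))) (cast-c₃ r t t≥1))
    (proj₂ (proj₂ (FromGraph.diameter-pair G p dr)))
  where open Cast
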